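{- Fix any $\epsilon>0$ and a positive integer $\rho$. There is a deterministic algorithm which, given positive integers $r_1,\ldots,r_m\le\rho$ and positive integers $c_1,\ldots,c_n$ with $r_1+\cdots+r_m=c_1+\cdots+c_n=N$, approximates the number of $m\times n$ contingency tables with row sums $r_1,\ldots,r_m$ and column sums $c_1,\ldots,c_n$ within a factor of $(1-\epsilon)^N$. The algorithm has quasi-polynomial complexity $m^{O(\log n)}$.
   Context: An $m\times n$ contingency table with row sums $r_1,\ldots,r_m$ and column sums $c_1,\ldots,c_n$ is an $m\times n$ matrix with non-negative integer entries having these row and column sums. The numbers $\epsilon$ and $\rho$ are fixed in advance. The row sums are bounded by the constant $\rho$; the column sums are allowed to be large (they are not assumed bounded by a constant). -}

module Defs where

open import Data.Bool using (if_then_else_)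
open import Data.Empty using (⊥-elim)
open import Data.Fin using (Fin)
open import Data.Integer using (+_)
open import Data.Nat using (ℕ; zero; suc; _+_; _∸_; _⊔_; _^_; _≡ᵇ_) renaming (_*_ to _*ℕ_)
open import Data.Nat.Logarithm using (⌊log₂_⌋)
open import Data.Product using (_×_; _,_)
open import Data.Rational using (ℚ; 1ℚ; _≤_; _-_; _*_; _/_; +-*-rawSemiring)
open import Data.Vec using (Vec; []; _∷_; map; sum; transpose)
open import Function.Bundles using (_↔_)
open import Relation.Binary.PropositionalEquality using (_≡_; _≢_; refl)

open import Algebra.Definitions.RawSemiring +-*-rawSemiring public
  using () renaming (_^_ to _^ℚ_)

record ContingencyTable {m n : ℕ} (r : Vec ℕ m) (c : Vec ℕ n) : Set where
  constructor table
  field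
    entries    : Vec (Vec ℕ n) m
    rowSums    : map sum entries ≡ r
    columnSums : map sum (transpose entries) ≡ c

HasCardinality : Set → ℕ → Set
HasCardinality A k = A ↔ Fin k

-- Structured programs for a random access machine, with finitely many named
-- integer variables and integer arrays in each program.  Addition and cut-off
-- subtraction are the only arithmetic instructions: each step lengthens the
-- largest stored number by at most one bit, so unit cost is polynomially
-- equivalent to Turing machine time.  (With a unit-cost multiplication it would
-- not be.)

Var Arr : Set
Var = ℕ
Arr = ℕ

infixr 4 _⨾_

data Program : Set where
  skip        : Program
  _≔const_    : Var → ℕ → Program
  _≔_⊞_       : Var → Var → Var → Program
  _≔_⊟_       : Var → Var → Var → Program
  _≔load_[_]  : Var → Arr → Var → Program
  store_[_]≔_ : Arr → Var → Var → Program
  _⨾_         : Program → Program → Program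
  ifNonzero_then_else_ : Var → Program → Program → Program
  whileNonzero_loop_     : Var → Program → Program

record State : Set where
  constructor ⟨_,_⟩
  field
    var : Var → ℕ
    arr : Arr → ℕ → ℕ
open State public

update : {A : Set} → (ℕ → A) → ℕ → A → ℕ → A
update f i v j = if i ≡ᵇ j then v else f j

setVar : State → Var → ℕ → State
setVar s x v = ⟨ update (var s) x v , arr s ⟩

setArr : State → Arr → ℕ → ℕ → State
setArr s a i v = ⟨ var s , update (arr s) a (update (arr s a) i v) ⟩

-- p , s ⇓[ t ] s′ : from state s, program p halts in state s′ after t steps,
-- where every elementary instruction and every test costs one step.
infix 3 _,_⇓[_]_

data _,_⇓[_]_ : Program → State → ℕ → State → Set where
  skip  : ∀ {s} → skip , s ⇓[ 1 ] s
  const : ∀ {s x k} → (x ≔const k) , s ⇓[ 1 ] setVar s x k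
  add   : ∀ {s x y z} → (x ≔ y ⊞ z) , s ⇓[ 1 ] setVar s x (var s y + var s z)
  sub   : ∀ {s x y z} → (x ≔ y ⊟ z) , s ⇓[ 1 ] setVar s x (var s y ∸ var s z)
  load  : ∀ {s x a y} → (x ≔load a [ y ]) , s ⇓[ 1 ] setVar s x (arr s a (var s y))
  store : ∀ {s a x y} → (store a [ x ]≔ y) , s ⇓[ 1 ] setArr s a (var s x) (var s y)
  seq   : ∀ {p q s s′ s″ t u} → p , s ⇓[ t ] s′ → q , s′ ⇓[ u ] s″ →
          (p ⨾ q) , s ⇓[ t + u ] s″
  if-nonzero : ∀ {x p q s s′ t} → var s x ≢ 0 → p , s ⇓[ t ] s′ →
               (ifNonzero x then p else q) , s ⇓[ suc t ] s′
  if-zero    : ∀ {x p q s s′ t} → var s x ≡ 0 → q , s ⇓[ t ] s′ →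
               (ifNonzero x then p else q) , s ⇓[ suc t ] s′
  while-nonzero : ∀ {x p s s′ s″ t u} → var s x ≢ 0 → p , s ⇓[ t ] s′ →
                  (whileNonzero x loop p) , s′ ⇓[ u ] s″ →
                  (whileNonzero x loop p) , s ⇓[ suc (t + u) ] s″
  while-zero    : ∀ {x p s} → var s x ≡ 0 → (whileNonzero x loop p) , s ⇓[ 1 ] s

-- The model is deterministic: final state and running time are unique.
⇓-deterministic : ∀ {p s t t′ s₁ s₂} → p , s ⇓[ t ] s₁ → p , s ⇓[ t′ ] s₂ →
                  (t ≡ t′) × (s₁ ≡ s₂)
⇓-deterministic skip skip = refl , refl
⇓-deterministic const const = refl , refl
⇓-deterministic add add = refl , refl
⇓-deterministic sub sub = refl , refl
⇓-deterministic load load = refl , refl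
⇓-deterministic store store = refl , refl
⇓-deterministic (seq a b) (seq a′ b′) with ⇓-deterministic a a′
... | refl , refl with ⇓-deterministic b b′
... | refl , refl = refl , refl
⇓-deterministic (if-nonzero _ a) (if-nonzero _ a′) with ⇓-deterministic a a′
... | refl , refl = refl , refl
⇓-deterministic (if-nonzero h _) (if-zero e _) = ⊥-elim (h e)
⇓-deterministic (if-zero e _) (if-nonzero h _) = ⊥-elim (h e)
⇓-deterministic (if-zero _ a) (if-zero _ a′) with ⇓-deterministic a a′
... | refl , refl = refl , refl
⇓-deterministic (while-nonzero _ a b) (while-nonzero _ a′ b′) with ⇓-deterministic a a′
... | refl , refl with ⇓-deterministic b b′
... | refl , refl = refl , refl
⇓-deterministic (while-nonzero h _ _) (while-zero e) = ⊥-elim (h e)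
⇓-deterministic (while-zero e) (while-nonzero h _ _) = ⊥-elim (h e)
⇓-deterministic (while-zero _) (while-zero _) = refl , refl

contents : ∀ {k} → Vec ℕ k → ℕ → ℕ
contents []       _       = 0
contents (x ∷ _)  zero    = x
contents (_ ∷ xs) (suc i) = contents xs i

-- Only the margins are input: m and n in variables 0 and 1, the row sums in
-- array 0 and the column sums in array 1; everything else is 0.
input : ∀ {m n} → Vec ℕ m → Vec ℕ n → State
input {m} {n} r c = ⟨ variables , arrays ⟩
  where
  variables : Var → ℕ
  variables 0 = m
  variables 1 = n
  variables _ = 0

  arrays : Arr → ℕ → ℕ
  arrays 0 = contents r
  arrays 1 = contents c
  arrays _ = λ _ → 0

-- A non-negative rational output, with denominator stored minus one.
output : State → ℚ
output s = (+ var s 0) / suc (var s 1)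

-- The two-sided bound (1-ε)^N ≤ α / k ≤ (1-ε)^(-N), with divisions cleared.
ApproximatesWithin : ℚ → ℕ → ℚ → ℕ → Set
ApproximatesWithin ε N α k =
  ((1ℚ - ε) ^ℚ N * ((+ k) / 1) ≤ α) × ((1ℚ - ε) ^ℚ N * α ≤ (+ k) / 1)

-- m^(C log n).  Rounding the logarithm only affects the constant C; the maxima
-- with 2 leave m, n ≥ 2 unchanged and keep the bound meaningful for m = 1 or
-- n = 1, where m^(C log n) would be 1 independently of the input length.
quasiPolynomial : ℕ → ℕ → ℕ → ℕ
quasiPolynomial C m n = (m ⊔ 2) ^ (C *ℕ ⌊log₂ (n ⊔ 2) ⌋)

{-# OPTIONS --safe #-}
-- With the row sums bounded by ρ, the tables can be counted exactly in polynomial time, so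
-- no approximation is needed.  Fill the table column by column and, within a column, row by
-- row.  The number of completions depends only on the column sum still to be met, the
-- multiset of residuals of the rows not yet treated in the column and the multiset of
-- residuals of the treated rows; since residuals are at most ρ, such a state is one number
-- with 2ρ + 1 digits in base N + 1, the low digit being the used part of the column sum and
-- the others counting the rows with each residual.  Treating always a row of largest
-- residual makes the count of a state the sum of at most ρ + 1 counts of smaller states, so
-- additions suffice.  Since N ≤ ρ m, the number of states is polynomial in m.
module Submission where

open import Defs
open import Axiom.UniquenessOfIdentityProofs.WithK using (uip)
open import Data.Bool using (T; true; false; if_then_else_)
open import Data.Empty using (⊥; ⊥-elim)
open import Data.Fin using (zero)
open import Data.Fin.Properties using (+↔⊎)
import Data.Integer as ℤ
open import Data.List using (List; []; _∷_; _++_; drop) renaming (map to mapˡ)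
open import Data.List.Membership.Propositional using (_∈_)
open import Data.List.Membership.Propositional.Properties using (∈-∃++)
open import Data.List.Properties using (++-identityʳ; map-id)
open import Data.List.Relation.Binary.Permutation.Propositional using (_↭_; refl; prep; swap; trans; ↭-sym)
open import Data.List.Relation.Binary.Permutation.Propositional.Properties using (All-resp-↭; map⁺; shift; ++⁺ʳ)
open import Data.List.Relation.Unary.All as Allˡ using ([]; _∷_) renaming (All to Allˡ)
open import Data.List.Relation.Unary.All.Properties using () renaming (++⁺ to All-++)
open import Data.List.Relation.Unary.Any as Any using (here; there)
open import Data.Nat using (ℕ; zero; suc; _+_; _∸_; _*_; _^_; _⊔_; _≤_; _<_; z≤n; s≤s; _≟_; _≤?_; _≡ᵇ_; NonZero; >-nonZero; >-nonZero⁻¹)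
open import Data.Nat.DivMod using (_%_; [m+kn]%n≡m%n; m<n⇒m%n≡m)
open import Data.Nat.ListAction using () renaming (sum to sumˡ)
open import Data.Nat.ListAction.Properties using (sum-↭; sum-++)
open import Data.Nat.Logarithm using (⌊log₂_⌋; ⌊log₂⌋-mono-≤)
open import Data.Nat.Properties
open import Data.Nat.Tactic.RingSolver using (solve-∀)
open import Data.Product using (_×_; _,_; ∃; Σ-syntax; proj₁; proj₂)
open import Data.Rational using (ℚ; 0ℚ; 1ℚ; NonNegative; nonNegative) renaming (_<_ to _<ℚ_)
import Data.Rational as ℚ
import Data.Rational.Properties as ℚ
open import Data.Sum using (_⊎_; inj₁; inj₂)
open import Data.Sum.Function.Propositional using (_⊎-↔_)
open import Data.Unit using (tt)
open import Data.Vec using (Vec; []; _∷_; map; sum; transpose; zipWith; toList; replicate; _⊛_)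
open import Data.Vec.Relation.Unary.All as All using (All; []; _∷_)
open import Function using (_∘_)
open import Function.Bundles using (_↔_; mk↔ₛ′)
open import Function.Properties.Inverse using (↔-trans; ↔-sym)
open import Relation.Binary.PropositionalEquality using (_≡_; _≢_; refl; sym; cong; cong₂; subst; subst₂; module ≡-Reasoning) renaming (trans to infixr 5 _∙_)
open import Relation.Nullary using (¬_; Dec; yes; no)

-- Counting functions and their symmetry.

-- Sums g (x ∸ t) (u + t) over t ≤ x.
spread : ℕ → ℕ → (ℕ → ℕ → ℕ) → ℕ
spread zero    u g = g 0 u
spread (suc x) u g = g (suc x) u + spread x (suc u) g

-- The number of ways to fill a column of sum c into rows with residual sums xs,
-- each weighted by K of the new residuals, when u of c is already used.
columnCount : ℕ → List ℕ → (List ℕ → ℕ) → ℕ → ℕ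
columnCount c []       K u = if u ≡ᵇ c then K [] else 0
columnCount c (x ∷ xs) K u = spread x u λ y → columnCount c xs (K ∘ (y ∷_))

tableCount : List ℕ → List ℕ → ℕ
tableCount []       xs = if sumˡ xs ≡ᵇ 0 then 1 else 0
tableCount (c ∷ cs) xs = columnCount c xs (tableCount cs) 0

spread-cong : ∀ x u {g h : ℕ → ℕ → ℕ} → (∀ y v → g y v ≡ h y v) → spread x u g ≡ spread x u h
spread-cong zero    u e = e 0 u
spread-cong (suc x) u e = cong₂ _+_ (e (suc x) u) (spread-cong x (suc u) e)

spread-+ : ∀ x u (g h : ℕ → ℕ → ℕ) →
           spread x u (λ y v → g y v + h y v) ≡ spread x u g + spread x u h
spread-+ zero    u g h = refl
spread-+ (suc x) u g h rewrite spread-+ x (suc u) g h =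
  interchange (g (suc x) u) (h (suc x) u) (spread x (suc u) g) (spread x (suc u) h)
  where
  interchange : ∀ a b c d → a + b + (c + d) ≡ a + c + (b + d)
  interchange = solve-∀

spread-shift : ∀ k x u (g : ℕ → ℕ → ℕ) → spread x u (λ y v → g y (k + v)) ≡ spread x (k + u) g
spread-shift k zero    u g = refl
spread-shift k (suc x) u g = cong (g (suc x) (k + u) +_)
  (spread-shift k x (suc u) g ∙ cong (λ v → spread x v g) (+-suc k u))

-- The two entries are chosen independently and `u` grows by their total, so the order of choice is
-- immaterial.
spread-comm : ∀ x x′ u (g : ℕ → ℕ → ℕ → ℕ) →
              spread x u (λ y v → spread x′ v (g y)) ≡
              spread x′ u (λ y′ v → spread x v (λ y → g y y′))
spread-comm zero    x′ u g = refl
spread-comm (suc x) x′ u g = begin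
  spread x′ u (g (suc x)) + spread x (suc u) (λ y v → spread x′ v (g y))
    ≡⟨ cong (spread x′ u (g (suc x)) +_) (spread-comm x x′ (suc u) g) ⟩
  spread x′ u (g (suc x)) + spread x′ (suc u) (λ y′ v → spread x v (λ y → g y y′))
    ≡⟨ cong (spread x′ u (g (suc x)) +_) (spread-shift 1 x′ u _) ⟨
  spread x′ u (g (suc x)) + spread x′ u (λ y′ v → spread x (suc v) (λ y → g y y′))
    ≡⟨ spread-+ x′ u (g (suc x)) _ ⟨
  spread x′ u (λ y′ v → spread (suc x) v (λ y → g y y′)) ∎
  where open ≡-Reasoning

Symmetric : (List ℕ → ℕ) → Set
Symmetric K = ∀ {xs ys} → xs ↭ ys → K xs ≡ K ys

columnCount-cong : ∀ c xs {K L : List ℕ → ℕ} → (∀ ys → K ys ≡ L ys) →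
                   ∀ u → columnCount c xs K u ≡ columnCount c xs L u
columnCount-cong c []       e u = cong (if u ≡ᵇ c then_else 0) (e [])
columnCount-cong c (x ∷ xs) e u = spread-cong x u λ y → columnCount-cong c xs (e ∘ (y ∷_))

-- Allows a row of largest residual to be treated first. In a swap, `spread-comm` exchanges the two
-- sums, and `S` undoes the exchange of the two new residuals inside `K`.
columnCount-↭ : ∀ c {xs ys} {K : List ℕ → ℕ} → Symmetric K → xs ↭ ys →
                ∀ u → columnCount c xs K u ≡ columnCount c ys K u
columnCount-↭ c S refl u = refl
columnCount-↭ c S (prep x p) u = spread-cong x u λ y → columnCount-↭ c (S ∘ prep y) p
columnCount-↭ c {x ∷ y ∷ xs} {_ ∷ _ ∷ ys} {K} S (swap _ _ p) u =
  spread-comm x y u (λ a b → columnCount c xs (λ zs → K (a ∷ b ∷ zs)))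
  ∙ spread-cong y u λ b v → spread-cong x v λ a w →
      columnCount-cong c xs (λ zs → S (swap a b refl)) w
      ∙ columnCount-↭ c (S ∘ prep b ∘ prep a) p w
columnCount-↭ c S (trans p q) u = columnCount-↭ c S p u ∙ columnCount-↭ c S q u

tableCount-↭ : ∀ cs → Symmetric (tableCount cs)
tableCount-↭ []       p = cong (λ s → if s ≡ᵇ 0 then 1 else 0) (sum-↭ p)
tableCount-↭ (c ∷ cs) p = columnCount-↭ c (tableCount-↭ cs) p 0

-- A row with residual 0 can only receive the entry 0, so every sum has a single term.
sum≡0⇒columnCount : ∀ c xs (K : List ℕ → ℕ) u → sumˡ xs ≡ 0 →
                    columnCount c xs K u ≡ (if u ≡ᵇ c then K xs else 0)
sum≡0⇒columnCount c []          K u e = refl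
sum≡0⇒columnCount c (zero ∷ xs) K u e = sum≡0⇒columnCount c xs (K ∘ (0 ∷_)) u e

-- The counting functions compute cardinalities

card-⊎ : ∀ {A B : Set} {a b} → HasCardinality A a → HasCardinality B b →
         HasCardinality (A ⊎ B) (a + b)
card-⊎ f g = ↔-trans (f ⊎-↔ g) (↔-sym +↔⊎)

card-spread : ∀ x u {A : ℕ → ℕ → Set} {g : ℕ → ℕ → ℕ} →
              (∀ t y → HasCardinality (A t y) (g y (u + t))) →
              HasCardinality (Σ[ t ∈ ℕ ] Σ[ y ∈ ℕ ] (t + y ≡ x) × A t y) (spread x u g)
card-spread zero u {A} {g} f =
  ↔-trans (mk↔ₛ′ (λ { (zero , zero , refl , a) → a }) (λ a → zero , zero , refl , a)
             (λ _ → refl) (λ { (zero , zero , refl , a) → refl }))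
          (subst (λ v → HasCardinality (A 0 0) (g 0 v)) (+-identityʳ u) (f 0 0))
card-spread (suc x) u {A} {g} f =
  ↔-trans split
    (card-⊎ (subst (λ v → HasCardinality (A 0 (suc x)) (g (suc x) v)) (+-identityʳ u) (f 0 (suc x)))
            (card-spread x (suc u)
              λ t y → subst (λ v → HasCardinality (A (suc t) y) (g y v)) (+-suc u t) (f (suc t) y)))
  where
  split : (Σ[ t ∈ ℕ ] Σ[ y ∈ ℕ ] (t + y ≡ suc x) × A t y) ↔
          (A 0 (suc x) ⊎ (Σ[ t ∈ ℕ ] Σ[ y ∈ ℕ ] (t + y ≡ x) × A (suc t) y))
  split = mk↔ₛ′
    (λ { (zero , .(suc x) , refl , a) → inj₁ a ; (suc t , y , refl , a) → inj₂ (t , y , refl , a) })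
    (λ { (inj₁ a) → zero , suc x , refl , a ; (inj₂ (t , y , refl , a)) → suc t , y , refl , a })
    (λ { (inj₁ a) → refl ; (inj₂ (t , y , refl , a)) → refl })
    (λ { (zero , .(suc x) , refl , a) → refl ; (suc t , y , refl , a) → refl })

card-⊥ : ∀ {A : Set} → (A → ⊥) → HasCardinality A 0
card-⊥ f = mk↔ₛ′ (⊥-elim ∘ f) (λ ()) (λ ()) (⊥-elim ∘ f)

card-if : ∀ (a b : ℕ) {A : Set} {k} → HasCardinality A k →
          HasCardinality ((a ≡ b) × A) (if a ≡ᵇ b then k else 0)
card-if a b f with a ≡ᵇ b in e
... | true  with refl ← ≡ᵇ⇒≡ a b (subst T (sym e) tt) =
  ↔-trans (mk↔ₛ′ proj₂ (refl ,_) (λ _ → refl) (λ { (refl , _) → refl })) f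
... | false = card-⊥ λ (p , _) → subst T e (≡⇒≡ᵇ a b p)

-- `v` is the column, `ys` are the residuals it leaves, and `A ys` stands for the fillings of the
-- later columns.
ColumnFilling : ∀ {m} → ℕ → Vec ℕ m → (Vec ℕ m → Set) → ℕ → Set
ColumnFilling {m} c xs A u =
  Σ[ v ∈ Vec ℕ m ] Σ[ ys ∈ Vec ℕ m ] (zipWith _+_ v ys ≡ xs) × (u + sum v ≡ c) × A ys

card-columnFilling : ∀ {m} c (xs : Vec ℕ m) {A : Vec ℕ m → Set} {K : List ℕ → ℕ} u →
                     (∀ ys → HasCardinality (A ys) (K (toList ys))) →
                     HasCardinality (ColumnFilling c xs A u) (columnCount c (toList xs) K u)
card-columnFilling c [] {A} u f =
  ↔-trans (mk↔ₛ′ (λ { ([] , [] , refl , e , a) → (sym (+-identityʳ u) ∙ e) , a })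
                 (λ { (e , a) → [] , [] , refl , (+-identityʳ u ∙ e) , a })
                 (λ { (e , a) → cong (_, a) (uip _ _) })
                 (λ { ([] , [] , refl , e , a) → cong (λ e → [] , [] , refl , e , a) (uip _ _) }))
          (card-if u c (f []))
card-columnFilling {suc m} c (x ∷ xs) {A} u f =
  ↔-trans split (card-spread x u λ t y → card-columnFilling c xs (u + t) (f ∘ (y ∷_)))
  where
  split : ColumnFilling c (x ∷ xs) A u ↔
          (Σ[ t ∈ ℕ ] Σ[ y ∈ ℕ ] (t + y ≡ x) × ColumnFilling c xs (A ∘ (y ∷_)) (u + t))
  split = mk↔ₛ′
    (λ { (t ∷ v , y ∷ ys , refl , e , a) → t , y , refl , v , ys , refl , (+-assoc u t (sum v) ∙ e) , a })
    (λ { (t , y , refl , v , ys , refl , e , a) →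
         t ∷ v , y ∷ ys , refl , (sym (+-assoc u t (sum v)) ∙ e) , a })
    (λ { (t , y , refl , v , ys , refl , e , a) →
         cong (λ e → t , y , refl , v , ys , refl , e , a) (uip _ _) })
    (λ { (t ∷ v , y ∷ ys , refl , e , a) →
         cong (λ e → t ∷ v , y ∷ ys , refl , e , a) (uip _ _) })

-- Chosen so that `transpose (v ∷ M)` reduces to `adjoinColumn v (transpose M)`.
adjoinColumn : ∀ {m n} → Vec ℕ n → Vec (Vec ℕ m) n → Vec (Vec ℕ (suc m)) n
adjoinColumn v M = (replicate _ _∷_ ⊛ v) ⊛ M

transpose-adjoinColumn : ∀ {m n} (v : Vec ℕ n) (M : Vec (Vec ℕ m) n) →
                         transpose (adjoinColumn v M) ≡ v ∷ transpose M
transpose-adjoinColumn []      []      = refl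
transpose-adjoinColumn (x ∷ v) (w ∷ M) = cong (adjoinColumn (x ∷ w)) (transpose-adjoinColumn v M)

transpose-replicate-[] : ∀ n → transpose (replicate n []) ≡ [] {A = Vec ℕ n}
transpose-replicate-[] zero    = refl
transpose-replicate-[] (suc n) rewrite transpose-replicate-[] n = refl

transpose-involutive : ∀ {m n} (M : Vec (Vec ℕ n) m) → transpose (transpose M) ≡ M
transpose-involutive {n = n} [] = transpose-replicate-[] n
transpose-involutive (v ∷ M) =
  transpose-adjoinColumn v (transpose M) ∙ cong (v ∷_) (transpose-involutive M)

map-sum-adjoinColumn : ∀ {m n} (v : Vec ℕ n) (M : Vec (Vec ℕ m) n) →
                       map sum (adjoinColumn v M) ≡ zipWith _+_ v (map sum M)
map-sum-adjoinColumn []      []      = refl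
map-sum-adjoinColumn (x ∷ v) (w ∷ M) = cong (x + sum w ∷_) (map-sum-adjoinColumn v M)

-- The outer vector lists the columns, so that induction splits off one column at a time, as
-- `tableCount` does.
ColumnTable : ∀ {m n} → Vec ℕ m → Vec ℕ n → Set
ColumnTable {m} {n} r c =
  Σ[ M ∈ Vec (Vec ℕ m) n ] (map sum (transpose M) ≡ r) × (map sum M ≡ c)

table↔columnTable : ∀ {m n} (r : Vec ℕ m) (c : Vec ℕ n) → ContingencyTable r c ↔ ColumnTable r c
table↔columnTable r c = mk↔ₛ′ to from to∘from from∘to
  where
  to : ContingencyTable r c → ColumnTable r c
  to (table E p q) = transpose E , (cong (map sum) (transpose-involutive E) ∙ p) , q
  from : ColumnTable r c → ContingencyTable r c
  from (M , p , q) = table (transpose M) p (cong (map sum) (transpose-involutive M) ∙ q)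
  ext : ∀ {M M′} p q p′ q′ → M ≡ M′ → _≡_ {A = ColumnTable r c} (M , p , q) (M′ , p′ , q′)
  ext p q p′ q′ refl = cong₂ (λ p q → _ , p , q) (uip p p′) (uip q q′)
  ext′ : ∀ {E E′} p q p′ q′ → E ≡ E′ → table {r = r} {c} E p q ≡ table E′ p′ q′
  ext′ p q p′ q′ refl = cong₂ (table _) (uip p p′) (uip q q′)
  to∘from : ∀ M → to (from M) ≡ M
  to∘from (M , p , q) = ext _ _ _ _ (transpose-involutive M)
  from∘to : ∀ E → from (to E) ≡ E
  from∘to (table E p q) = ext′ _ _ _ _ (transpose-involutive E)

-- The residuals left by the first column are forced to be the row sums of the remaining columns, so
-- recording them adds no choice.
columnTable-∷ : ∀ {m n} (r : Vec ℕ m) c (cs : Vec ℕ n) →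
                ColumnTable r (c ∷ cs) ↔ ColumnFilling c r (λ ys → ColumnTable ys cs) 0
columnTable-∷ r c cs = mk↔ₛ′ to from to∘from from∘to
  where
  to : ColumnTable r (c ∷ cs) → ColumnFilling c r (λ ys → ColumnTable ys cs) 0
  to (v ∷ M , p , refl) =
    v , map sum (transpose M) , (sym (map-sum-adjoinColumn v (transpose M)) ∙ p) , refl , M , refl , refl
  from : ColumnFilling c r (λ ys → ColumnTable ys cs) 0 → ColumnTable r (c ∷ cs)
  from (v , .(map sum (transpose M)) , p , refl , M , refl , refl) =
    v ∷ M , (map-sum-adjoinColumn v (transpose M) ∙ p) , refl
  to∘from : ∀ F → to (from F) ≡ F
  to∘from (v , .(map sum (transpose M)) , p , refl , M , refl , refl) =
    cong (λ p → v , _ , p , refl , M , refl , refl) (uip _ _)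
  from∘to : ∀ M → from (to M) ≡ M
  from∘to (v ∷ M , p , refl) = cong (λ p → v ∷ M , p , refl) (uip _ _)

card-columnTable : ∀ {m n} (c : Vec ℕ n) (r : Vec ℕ m) →
                   HasCardinality (ColumnTable r c) (tableCount (toList c) (toList r))
card-columnTable [] r =
  ↔-trans (mk↔ₛ′ (λ { ([] , p , refl) → zeros r p , zero })
                 (λ { (p , zero) → [] , zeros′ r p , refl })
                 (λ { (p , zero) → cong (_, zero) (uip _ _) })
                 (λ { ([] , p , refl) → cong (λ p → [] , p , refl) (uip _ _) }))
          (card-if (sumˡ (toList r)) 0 (mk↔ₛ′ (λ i → i) (λ i → i) (λ _ → refl) (λ _ → refl)))
  where
  zeros : ∀ {m} (r : Vec ℕ m) → map sum (replicate m []) ≡ r → sumˡ (toList r) ≡ 0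
  zeros []                  refl = refl
  zeros {suc m} (.0 ∷ .(_)) refl = zeros (map sum (replicate m [])) refl
  zeros′ : ∀ {m} (r : Vec ℕ m) → sumˡ (toList r) ≡ 0 → map sum (replicate m []) ≡ r
  zeros′ []         _ = refl
  zeros′ (zero ∷ r) e = cong (0 ∷_) (zeros′ r e)
card-columnTable (c ∷ cs) r =
  ↔-trans (columnTable-∷ r c cs) (card-columnFilling c r 0 (card-columnTable cs))

card-contingencyTable : ∀ {m n} (r : Vec ℕ m) (c : Vec ℕ n) →
                        HasCardinality (ContingencyTable r c) (tableCount (toList c) (toList r))
card-contingencyTable r c = ↔-trans (table↔columnTable r c) (card-columnTable c r)

-- Supplies `t + y ≡ x` to the pointwise proof, which uses it to see that a step leads to a valid
-- state of smaller index.
spread-cong-+ : ∀ x u {g h : ℕ → ℕ → ℕ} →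
                (∀ t y → t + y ≡ x → g y (u + t) ≡ h y (u + t)) → spread x u g ≡ spread x u h
spread-cong-+ zero u {g} {h} e =
  subst (λ v → g 0 v ≡ h 0 v) (+-identityʳ u) (e 0 0 refl)
spread-cong-+ (suc x) u {g} {h} e = cong₂ _+_
  (subst (λ v → g (suc x) v ≡ h (suc x) v) (+-identityʳ u) (e 0 (suc x) refl))
  (spread-cong-+ x (suc u) λ t y p →
    subst (λ v → g y v ≡ h y v) (+-suc u t) (e (suc t) y (cong suc p)))

-- Encoding of states

module Codes (N ρ : ℕ) where

  -- Rows with residual 0 are not recorded.
  weight : ℕ → ℕ → ℕ
  weight k zero    = 0
  weight k (suc y) = suc N ^ (k + suc y)

  code : ℕ → List ℕ → ℕ
  code k xs = sumˡ (mapˡ (weight k) xs)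

  -- xs are the residuals of the rows not yet treated in the current column, ys those
  -- of the treated rows, and u is the part of the column sum used up.
  index : List ℕ → List ℕ → ℕ → ℕ
  index xs ys u = u + (code 0 ys + code ρ xs)

  -- total≤ keeps every digit at most N, so that no carries occur.
  record Valid (xs ys : List ℕ) (u : ℕ) : Set where
    constructor valid
    field
      rest≤ρ : Allˡ (_≤ ρ) xs
      done≤ρ : Allˡ (_≤ ρ) ys
      total≤ : u + (sumˡ ys + sumˡ xs) ≤ N

  code-↭ : ∀ k {xs ys} → xs ↭ ys → code k xs ≡ code k ys
  code-↭ k p = sum-↭ (map⁺ (weight k) p)

  weight-pos : ∀ {e} → 1 ≤ e → weight 0 e ≡ suc N ^ e
  weight-pos {suc e} _ = refl

  code-++ : ∀ k xs ys → code k (xs ++ ys) ≡ code k xs + code k ys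
  code-++ k []       ys = refl
  code-++ k (x ∷ xs) ys = cong (weight k x +_) (code-++ k xs ys) ∙ sym (+-assoc (weight k x) _ _)

  sum≡0⇒code≡0 : ∀ k xs → sumˡ xs ≡ 0 → code k xs ≡ 0
  sum≡0⇒code≡0 k []          _ = refl
  sum≡0⇒code≡0 k (zero ∷ xs) e = sum≡0⇒code≡0 k xs e

  code≡0⇒sum≡0 : ∀ k xs → code k xs ≡ 0 → sumˡ xs ≡ 0
  code≡0⇒sum≡0 k []           _ = refl
  code≡0⇒sum≡0 k (zero ∷ xs)  e = code≡0⇒sum≡0 k xs e
  code≡0⇒sum≡0 k (suc x ∷ xs) e =
    ⊥-elim (<⇒≢ (m^n>0 (suc N) (k + suc x)) (sym (m+n≡0⇒m≡0 _ e)))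

  code-shift : ∀ k ys → code k ys ≡ suc N ^ k * code 0 ys
  code-shift k []       = sym (*-zeroʳ (suc N ^ k))
  code-shift k (y ∷ ys) = cong₂ _+_ (weight-shift y) (code-shift k ys)
    ∙ sym (*-distribˡ-+ (suc N ^ k) (weight 0 y) (code 0 ys))
    where
    weight-shift : ∀ y → weight k y ≡ suc N ^ k * weight 0 y
    weight-shift zero    = sym (*-zeroʳ (suc N ^ k))
    weight-shift (suc y) = ^-distribˡ-+-* (suc N) k (suc y)

  -- Nonzero residuals have positive powers of the base as weights, so the low digit of an index is
  -- `u` alone.
  code-multiple : ∀ ys → ∃ λ w → code 0 ys ≡ w * suc N
  code-multiple []           = 0 , refl
  code-multiple (zero ∷ ys)  = code-multiple ys
  code-multiple (suc y ∷ ys) with w , e ← code-multiple ys =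
    suc N ^ y + w ,
    (cong₂ _+_ (*-comm (suc N) (suc N ^ y)) e ∙ sym (*-distribʳ-+ (suc N) (suc N ^ y) w))

  -- A row with nonzero residual contributes a single power to the code, and at least 1 to the sum.
  code≤ : ∀ k l xs → Allˡ (λ x → k + x ≤ l) xs → code k xs ≤ sumˡ xs * suc N ^ l
  code≤ k l []       []       = z≤n
  code≤ k l (x ∷ xs) (p ∷ ps) = ≤-trans (+-mono-≤ (weight≤ x p) (code≤ k l xs ps))
    (≤-reflexive (sym (*-distribʳ-+ (suc N ^ l) x (sumˡ xs))))
    where
    weight≤ : ∀ x → k + x ≤ l → weight k x ≤ x * suc N ^ l
    weight≤ zero    _ = z≤n
    weight≤ (suc x) p = ≤-trans (^-monoʳ-≤ (suc N) p) (m≤m+n _ _)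

  -- By `code≤`, each part of the index is at most its share of the total times `suc N ^ (ρ + s)`,
  -- and the total is below the base `suc N`.
  index< : ∀ {xs ys u} s → Valid xs ys u → Allˡ (_≤ s) xs → index xs ys u < suc N ^ suc (ρ + s)
  index< {xs} {ys} {u} s (valid _ ps q) rs = begin-strict
    u + (code 0 ys + code ρ xs)           ≤⟨ +-mono-≤ (m≤m*n u P) (+-mono-≤
                                               (code≤ 0 (ρ + s) ys (Allˡ.map (λ p → ≤-trans p (m≤m+n ρ s)) ps))
                                               (code≤ ρ (ρ + s) xs (Allˡ.map (+-monoʳ-≤ ρ) rs))) ⟩
    u * P + (sumˡ ys * P + sumˡ xs * P)   ≡⟨ factor u (sumˡ ys) (sumˡ xs) P ⟩
    (u + (sumˡ ys + sumˡ xs)) * P         ≤⟨ *-monoˡ-≤ P q ⟩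
    N * P                                 <⟨ +-monoˡ-≤ (N * P) (m^n>0 (suc N) (ρ + s)) ⟩
    P + N * P                             ∎
    where
    open ≤-Reasoning
    P = suc N ^ (ρ + s)
    instance
      P≢0 : NonZero P
      P≢0 = m^n≢0 (suc N) (ρ + s)
    factor : ∀ a b c d → a * d + (b * d + c * d) ≡ (a + (b + c)) * d
    factor = solve-∀

  ∈⇒weight≤ : ∀ k {x xs} → x ∈ xs → weight k x ≤ code k xs
  ∈⇒weight≤ k (here refl) = m≤m+n _ _
  ∈⇒weight≤ k (there p)   = ≤-trans (∈⇒weight≤ k p) (m≤n+m _ _)

  -- A residual above `s` would contribute a weight of at least `suc N ^ suc (ρ + s)`.
  index<⇒All≤ : ∀ {xs} ys u s → index xs ys u < suc N ^ suc (ρ + s) → Allˡ (_≤ s) xs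
  index<⇒All≤ {xs} ys u s p = Allˡ.tabulate λ {x} x∈ → ≮⇒≥ λ s<x → <⇒≱ p (large s<x x∈)
    where
    large : ∀ {x} → s < x → x ∈ xs → suc N ^ suc (ρ + s) ≤ index xs ys u
    large {suc x} (s≤s s≤x) x∈ = begin
      suc N ^ suc (ρ + s)   ≡⟨ cong (suc N ^_) (+-suc ρ s) ⟨
      suc N ^ (ρ + suc s)   ≤⟨ ^-monoʳ-≤ (suc N) (+-monoʳ-≤ ρ (s≤s s≤x)) ⟩
      suc N ^ (ρ + suc x)   ≤⟨ ∈⇒weight≤ ρ x∈ ⟩
      code ρ xs             ≤⟨ m≤n+m _ _ ⟩
      code 0 ys + code ρ xs ≤⟨ m≤n+m _ u ⟩
      index xs ys u         ∎
      where open ≤-Reasoning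

  index<⇒sum≡0 : ∀ {xs} ys u → index xs ys u < suc N ^ suc ρ → sumˡ xs ≡ 0
  index<⇒sum≡0 {xs} ys u p =
    zeros (index<⇒All≤ {xs} ys u 0 (subst (λ e → index xs ys u < suc N ^ suc e) (sym (+-identityʳ ρ)) p))
    where
    zeros : ∀ {xs} → Allˡ (_≤ 0) xs → sumˡ xs ≡ 0
    zeros []         = refl
    zeros (z≤n ∷ ps) = zeros ps

  ∉⇒All≤ : ∀ {s xs} → ¬ (suc s ∈ xs) → Allˡ (_≤ suc s) xs → Allˡ (_≤ s) xs
  ∉⇒All≤ n []       = []
  ∉⇒All≤ n (p ∷ ps) = ≤-pred (≤∧≢⇒< p (n ∘ here ∘ sym)) ∷ ∉⇒All≤ (n ∘ there) ps

  -- The bounds place the leading digit at `ρ + suc s`. Without a row of residual `suc s`, all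
  -- residuals would be at most `s`, and `index<` would contradict the lower bound.
  extract-largest : ∀ {xs ys u} s → Valid xs ys u →
                    suc N ^ (ρ + suc s) ≤ index xs ys u →
                    index xs ys u < suc N ^ suc (ρ + suc s) →
                    ∃ λ xs′ → xs ↭ suc s ∷ xs′
  extract-largest {xs} {ys} {u} s v lo hi with Any.any? (suc s ≟_) xs
  ... | yes p with as , bs , refl ← ∈-∃++ p = as ++ bs , shift (suc s) as bs
  ... | no n = ⊥-elim (<⇒≱ (index< s v (∉⇒All≤ n (index<⇒All≤ ys u (suc s) hi)))
                           (subst (λ e → suc N ^ e ≤ index xs ys u) (+-suc ρ s) lo))

  valid-↭ : ∀ {xs xs′ ys u} → xs ↭ xs′ → Valid xs ys u → Valid xs′ ys u
  valid-↭ {ys = ys} {u} p (valid a b c) =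
    valid (All-resp-↭ p a) b (subst (λ s → u + (sumˡ ys + s) ≤ N) (sum-↭ p) c)

  -- The entry `t` passes from the residuals to `u`, so the total stays the same.
  valid-step : ∀ {xs ys u} t y → Valid (t + y ∷ xs) ys u → Valid xs (y ∷ ys) (u + t)
  valid-step {xs} {ys} {u} t y (valid (a ∷ as) b c) =
    valid as (≤-trans (m≤n+m y t) a ∷ b)
          (subst (_≤ N) (regroup u t y (sumˡ ys) (sumˡ xs)) c)
    where
    regroup : ∀ u t y b a → u + (b + (t + y + a)) ≡ u + t + (y + b + a)
    regroup = solve-∀

  step-index : ∀ xs ys v y → index xs (y ∷ ys) v ≡ (code 0 ys + code ρ xs) + v + weight 0 y
  step-index xs ys v y = regroup v (weight 0 y) (code 0 ys) (code ρ xs)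
    where
    regroup : ∀ v w a b → v + (w + a + b) ≡ a + b + v + w
    regroup = solve-∀

  weight≤pow : ∀ y → weight 0 y ≤ suc N ^ y
  weight≤pow zero    = z≤n
  weight≤pow (suc y) = ≤-refl

  -- Adding 1 to `t` adds 1 on the left but at least doubles the right side.
  pow+≤ : 1 ≤ N → ∀ t y → suc N ^ y + t ≤ suc N ^ (t + y)
  pow+≤ _ zero y = ≤-reflexive (+-identityʳ _)
  pow+≤ 1≤N (suc t) y = begin
    suc N ^ y + suc t                ≡⟨ +-suc _ t ⟩
    suc (suc N ^ y + t)              ≤⟨ s≤s (pow+≤ 1≤N t y) ⟩
    suc P                            ≤⟨ +-monoˡ-≤ P (m^n>0 (suc N) (t + y)) ⟩
    P + P                            ≤⟨ +-monoʳ-≤ P (subst (_≤ N * P) (*-identityˡ P) (*-monoˡ-≤ P 1≤N)) ⟩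
    P + N * P                        ∎
    where
    open ≤-Reasoning
    P = suc N ^ (t + y)

  -- The weight `suc N ^ (ρ + suc s)` is exchanged for at most `suc N ^ suc s`, which is less as `ρ`
  -- is positive. Hence filling a layer in increasing order of index finds all terms of a sum ready.
  step-index< : 1 ≤ N → 1 ≤ ρ → ∀ xs ys u t y s → t + y ≡ suc s →
                index xs (y ∷ ys) (u + t) < index (suc s ∷ xs) ys u
  step-index< 1≤N 1≤ρ xs ys u t y s e = begin-strict
    index xs (y ∷ ys) (u + t)         ≡⟨ regroup u t (weight 0 y) (code 0 ys) (code ρ xs) ⟩
    index xs ys u + (weight 0 y + t)  ≤⟨ +-monoʳ-≤ _ (≤-trans (+-monoˡ-≤ t (weight≤pow y)) (pow+≤ 1≤N t y)) ⟩
    index xs ys u + suc N ^ (t + y)   <⟨ +-monoʳ-< (index xs ys u) (^-monoʳ-< (suc N) (s≤s 1≤N) t+y<) ⟩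
    index xs ys u + suc N ^ (ρ + suc s) ≡⟨ regroup′ u (suc N ^ (ρ + suc s)) (code 0 ys) (code ρ xs) ⟩
    index (suc s ∷ xs) ys u           ∎
    where
    open ≤-Reasoning
    t+y< : t + y < ρ + suc s
    t+y< = subst (_< ρ + suc s) (sym e) (+-monoˡ-≤ (suc s) 1≤ρ)
    regroup : ∀ u t w a b → u + t + (w + a + b) ≡ u + (a + b) + (w + t)
    regroup = solve-∀
    regroup′ : ∀ u p a b → u + (a + b) + p ≡ u + (a + (p + b))
    regroup′ = solve-∀

-- Program logic with time bounds

record Runs (p : Program) (s : State) (T : ℕ) (Q : State → Set) : Set where
  constructor runs
  field
    {time}  : ℕ
    {final} : State
    steps   : p , s ⇓[ time ] final
    time≤   : time ≤ T
    post    : Q final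

last : ∀ {p s s′} {Q : State → Set} → p , s ⇓[ 1 ] s′ → Q s′ → Runs p s 1 Q
last d q = runs d ≤-refl q

infixr 4 _⟫_
_⟫_ : ∀ {p q s s′ T Q} → p , s ⇓[ 1 ] s′ → Runs q s′ T Q → Runs (p ⨾ q) s (suc T) Q
d ⟫ runs e t q = runs (seq d e) (s≤s t) q

bind : ∀ {p q s T U} {P Q : State → Set} →
       Runs p s T P → (∀ s′ → P s′ → Runs q s′ U Q) → Runs (p ⨾ q) s (T + U) Q
bind (runs d t h) f with runs e u q ← f _ h = runs (seq d e) (+-mono-≤ t u) q

slower : ∀ {p s T U Q} → T ≤ U → Runs p s T Q → Runs p s U Q
slower l (runs d t q) = runs d (≤-trans t l) q

mapPost : ∀ {p s T} {P Q : State → Set} → (∀ {s′} → P s′ → Q s′) → Runs p s T P → Runs p s T Q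
mapPost f (runs d t h) = runs d t (f h)

-- `k` is the number of rounds left. Each costs at most `T` and one test, and the failing test at
-- the end costs one more step.
countdown : ∀ {x p T} (I : ℕ → State → Set) → (∀ {k s} → I k s → var s x ≡ k) →
            (∀ k s → I (suc k) s → Runs p s T (I k)) →
            ∀ k s → I k s → Runs (whileNonzero x loop p) s (suc (k * suc T)) (I 0)
countdown I x≡ body zero s i = runs (while-zero (x≡ i)) ≤-refl i
countdown {T = T} I x≡ body (suc k) s i
  with runs d t h ← body k s i
  with runs e u q ← countdown I x≡ body k _ h =
  runs (while-nonzero (λ x≡0 → 1+n≢0 (sym (x≡ i) ∙ x≡0)) d e)
       (s≤s (≤-trans (+-mono-≤ t u) (≤-reflexive (+-suc T (k * suc T))))) q

ifYes : ∀ {x p q s T Q} → var s x ≢ 0 → Runs p s T Q → Runs (ifNonzero x then p else q) s (suc T) Q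
ifYes x≢0 (runs d t q) = runs (if-nonzero x≢0 d) (s≤s t) q

ifNo : ∀ {x p q s T Q} → var s x ≡ 0 → Runs q s T Q → Runs (ifNonzero x then p else q) s (suc T) Q
ifNo x≡0 (runs d t q) = runs (if-zero x≡0 d) (s≤s t) q

-- Conditionals, array updates and array contents.

if-refl : ∀ a k → (if a ≡ᵇ a then k else 0) ≡ k
if-refl zero    k = refl
if-refl (suc a) k = if-refl a k

if-≢ : ∀ {a b} k → a ≢ b → (if a ≡ᵇ b then k else 0) ≡ 0
if-≢ {zero}  {zero}  k n = ⊥-elim (n refl)
if-≢ {zero}  {suc b} k n = refl
if-≢ {suc a} {zero}  k n = refl
if-≢ {suc a} {suc b} k n = if-≢ k (n ∘ cong suc)

update-≡ : ∀ (f : ℕ → ℕ) i v → update f i v i ≡ v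
update-≡ f zero    v = refl
update-≡ f (suc i) v = update-≡ (f ∘ suc) i v

update-≢ : ∀ (f : ℕ → ℕ) {i} v {j} → i ≢ j → update f i v j ≡ f j
update-≢ f {zero}  v {zero}  n = ⊥-elim (n refl)
update-≢ f {zero}  v {suc j} n = refl
update-≢ f {suc i} v {zero}  n = refl
update-≢ f {suc i} v {suc j} n = update-≢ (f ∘ suc) v (n ∘ cong suc)

-- Takes the last index first, like the loops that count down through an array.
partialSum : (ℕ → ℕ) → ℕ → ℕ
partialSum f zero    = 0
partialSum f (suc k) = f k + partialSum f k

-- Splits off the other end, to match the recursion of `contents`.
partialSum-suc : ∀ f k → partialSum f (suc k) ≡ f 0 + partialSum (f ∘ suc) k
partialSum-suc f zero    = refl
partialSum-suc f (suc k) =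
  cong (f (suc k) +_) (partialSum-suc f k) ∙ exchange (f (suc k)) (f 0) (partialSum (f ∘ suc) k)
  where
  exchange : ∀ a b c → a + (b + c) ≡ b + (a + c)
  exchange = solve-∀

partialSum-contents : ∀ g {m} (r : Vec ℕ m) →
                      partialSum (g ∘ contents r) m ≡ sumˡ (mapˡ g (toList r))
partialSum-contents g []      = refl
partialSum-contents g {suc m} (x ∷ r) =
  partialSum-suc (g ∘ contents (x ∷ r)) m ∙ cong (g x +_) (partialSum-contents g r)

drop-contents : ∀ {n} (c : Vec ℕ n) j → j < n →
                drop j (toList c) ≡ contents c j ∷ drop (suc j) (toList c)
drop-contents (x ∷ c) zero    p       = refl
drop-contents (x ∷ c) (suc j) (s≤s p) = drop-contents c j p

drop-all : ∀ {n} (c : Vec ℕ n) → drop n (toList c) ≡ []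
drop-all []      = refl
drop-all (x ∷ c) = drop-all c

contents-All : ∀ {P : ℕ → Set} {n} (c : Vec ℕ n) → Allˡ P (toList c) → ∀ j → j < n → P (contents c j)
contents-All (x ∷ c) (p ∷ ps) zero    _       = p
contents-All (x ∷ c) (p ∷ ps) (suc j) (s≤s l) = contents-All c ps j l

-- The program

-- null is never assigned, so that x ≔ y ⊞ null copies y to x.
rowsLeft columns one null base source target counter position offset acc ptr tmp stride layerSize : Var
rowsLeft  = 0
columns   = 1
one       = 2
null      = 3
base      = 4
source    = 5
target    = 6
counter   = 7
position  = 8
offset    = 9
acc       = 10
ptr       = 11
tmp       = 12
stride    = 13
layerSize = 14

-- counts consists of layers of B ^ (2ρ + 1) entries, B = N + 1, one for each column and an
-- initial one for the empty table; entry index xs ys u of a layer is the count of that state.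
rowSum columnSum weights counts : Arr
rowSum    = 0
columnSum = 1
weights   = 2
counts    = 3

multiplyByBase : Program
multiplyByBase =
  counter ≔ base ⊞ null ⨾
  ptr ≔const 0 ⨾
  (whileNonzero counter loop
    (ptr ≔ ptr ⊞ acc ⨾
     counter ≔ counter ⊟ one)) ⨾
  acc ≔ ptr ⊞ null

-- Unrolled when the program is built, as the number of weights depends only on `ρ`. Entry 0 is
-- never written and keeps the value `weight 0 0`.
fillWeights : ℕ → ℕ → Program
fillWeights e zero    = skip
fillWeights e (suc f) =
  multiplyByBase ⨾
  tmp ≔const suc e ⨾
  store weights [ tmp ]≔ acc ⨾
  fillWeights (suc e) f

-- Decrementing the residual increments the used part of the column sum, hence ptr.
addTerms : ℕ → Program
addTerms zero =
  tmp ≔load counts [ ptr ] ⨾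
  acc ≔ acc ⊞ tmp
addTerms (suc y) =
  tmp ≔const suc y ⨾
  tmp ≔load weights [ tmp ] ⨾
  tmp ≔ ptr ⊞ tmp ⨾
  tmp ≔load counts [ tmp ] ⨾
  acc ≔ acc ⊞ tmp ⨾
  ptr ≔ ptr ⊞ one ⨾
  addTerms y

-- The first weight ≤ offset, tested as (offset + 1) ∸ weight ≠ 0, belongs to the leading
-- digit of offset, which is the largest residual of an untreated row.
updateEntry : ℕ → ℕ → Program
-- No untreated row has a positive residual: `startColumn` has copied the entry or rightly left it
-- 0.
updateEntry ρ zero    = skip
updateEntry ρ (suc s) =
  tmp ≔const (ρ + suc s) ⨾
  tmp ≔load weights [ tmp ] ⨾
  ptr ≔ offset ⊞ one ⨾
  ptr ≔ ptr ⊟ tmp ⨾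
  (ifNonzero ptr
   then (ptr ≔ position ⊟ tmp ⨾
         acc ≔const 0 ⨾
         addTerms (suc s) ⨾
         store counts [ position ]≔ acc)
   else updateEntry ρ s)

-- When the column sum is met, all treated rows become untreated ones of the next column,
-- which multiplies their code by B ^ ρ: entry d + v * B, with d the column sum, is entry
-- v * B ^ (ρ + 1) of the previous layer.
startColumn : Program
startColumn =
  tmp ≔load counts [ source ] ⨾
  store counts [ target ]≔ tmp ⨾
  source ≔ source ⊞ stride ⨾
  target ≔ target ⊞ base ⨾
  counter ≔ counter ⊟ one

fillEntry : ℕ → Program
fillEntry ρ =
  updateEntry ρ ρ ⨾
  offset ≔ offset ⊞ one ⨾
  position ≔ position ⊞ one ⨾
  counter ≔ counter ⊟ one

fillLayer : ℕ → Program
fillLayer ρ =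
  -- Columns are taken from last to first, so each layer counts tables for a final segment of the
  -- column sums.
  columns ≔ columns ⊟ one ⨾
  tmp ≔load columnSum [ columns ] ⨾
  target ≔ position ⊞ tmp ⨾
  tmp ≔const ρ ⨾
  counter ≔load weights [ tmp ] ⨾
  -- The `B ^ ρ` rounds move `source` by `B ^ ρ * B ^ (ρ + 1)`, one whole layer. It ends at the
  -- layer being filled, ready for the next column.
  (whileNonzero counter loop startColumn) ⨾
  offset ≔const 0 ⨾
  counter ≔ layerSize ⊞ null ⨾
  (whileNonzero counter loop fillEntry ρ)

addRowSum : Program
addRowSum =
  counter ≔ counter ⊟ one ⨾
  tmp ≔load rowSum [ counter ] ⨾
  base ≔ base ⊞ tmp

addRowWeight : ℕ → Program
addRowWeight ρ =
  rowsLeft ≔ rowsLeft ⊟ one ⨾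
  tmp ≔load rowSum [ rowsLeft ] ⨾
  acc ≔const ρ ⨾
  tmp ≔ acc ⊞ tmp ⨾
  tmp ≔load weights [ tmp ] ⨾
  source ≔ source ⊞ tmp

-- The loop over the columns leaves 0 in variable 1, making the denominator of the output 1.
countTables : ℕ → Program
countTables ρ =
  one ≔const 1 ⨾
  -- Starting from 1, the base becomes `N + 1` once all row sums are added.
  base ≔const 1 ⨾
  counter ≔ rowsLeft ⊞ null ⨾
  (whileNonzero counter loop addRowSum) ⨾
  acc ≔const 1 ⨾
  fillWeights 0 (suc (ρ + ρ)) ⨾
  layerSize ≔ acc ⊞ null ⨾
  position ≔ acc ⊞ null ⨾
  tmp ≔const suc ρ ⨾
  stride ≔load weights [ tmp ] ⨾
  store counts [ null ]≔ one ⨾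
  (whileNonzero columns loop fillLayer ρ) ⨾
  (whileNonzero rowsLeft loop addRowWeight ρ) ⨾
  -- `source` was the start of the last layer and has been advanced by the code of the row sums.
  rowsLeft ≔load counts [ source ]

termTime : ℕ → ℕ
termTime zero    = 2
termTime (suc y) = 6 + termTime y

-- Adding the times of both branches of the test bounds each of them.
updateTime : ℕ → ℕ
updateTime zero    = 1
updateTime (suc s) = 5 + (2 + (termTime (suc s) + 1) + updateTime s)

-- Correctness of the program

module Machine (N ρ : ℕ) (1≤N : 1 ≤ N) (1≤ρ : 1 ≤ ρ) {m n : ℕ} (r : Vec ℕ m) (c : Vec ℕ n)
               (rows≥1 : Allˡ (1 ≤_) (toList r)) (rows≤ρ : Allˡ (_≤ ρ) (toList r))
               (columns≤N : Allˡ (_≤ N) (toList c)) (sum-r : sumˡ (toList r) ≡ N) where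
  open Codes N ρ

  B S L : ℕ
  B = suc N
  S = B ^ suc ρ
  L = B ^ suc (ρ + ρ)

  Common : State → Set
  Common s = var s one ≡ 1 × var s null ≡ 0 × arr s rowSum ≡ contents r × arr s columnSum ≡ contents c

  Ready : State → Set
  Ready s = Common s × var s base ≡ B × var s stride ≡ S × var s layerSize ≡ L × var s rowsLeft ≡ m ×
            (∀ e → e ≤ suc (ρ + ρ) → arr s weights e ≡ weight 0 e)

  -- `R` holds whatever the caller wants carried through; it has to survive assignments to the three
  -- variables that `addTerms` changes.
  addTerms-runs : (R : State → Set) →
    (∀ {s v} → R s → R (setVar s tmp v)) → (∀ {s v} → R s → R (setVar s acc v)) →
    (∀ {s v} → R s → R (setVar s ptr v)) → (∀ {s} → R s → Ready s) →
    ∀ (F : ℕ → ℕ) D y v a s → y ≤ suc (ρ + ρ) → var s ptr ≡ D + v → var s acc ≡ a →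
    arr s counts ≡ F → R s →
    Runs (addTerms y) s (termTime y)
      λ s′ → R s′ × (var s′ acc ≡ a + spread y v λ y v → F (D + v + weight 0 y))
  addTerms-runs R t! a! p! ready F D zero v a s _ p≡ a≡ F≡ h =
    load ⟫ last add
      (a! (t! h) , cong₂ _+_ a≡ (cong₂ (λ f i → f i) F≡ (p≡ ∙ sym (+-identityʳ (D + v)))))
  addTerms-runs R t! a! p! ready F D (suc y) v a s y≤ p≡ a≡ F≡ h =
    const ⟫ load ⟫ add ⟫ load ⟫ add ⟫ add ⟫
    mapPost (λ (h , e) → h , (e ∙ +-assoc a _ _))
     (addTerms-runs R t! a! p! ready F D y (suc v) _ _ (≤-trans (n≤1+n y) y≤)
      (cong₂ _+_ p≡ one≡ ∙ (+-assoc D v 1 ∙ cong (D +_) (+-comm v 1)))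
      (cong₂ _+_ a≡ (cong₂ (λ f i → f i) F≡ (cong₂ _+_ p≡ (w≡ (suc y) y≤))))
      F≡ (p! (a! (t! (t! (t! (t! h)))))))
    where
    one≡ = proj₁ (proj₁ (ready h))
    w≡ = proj₂ (proj₂ (proj₂ (proj₂ (proj₂ (ready h)))))

  -- These are the states between two columns, with `ys` empty and `u` equal to 0, so the index is
  -- just `code ρ xs`.
  Layer : List ℕ → ℕ → (ℕ → ℕ) → Set
  Layer cs p F = ∀ xs → Allˡ (_≤ ρ) xs → sumˡ xs ≤ N → F (p + code ρ xs) ≡ tableCount cs xs

  module FillLayer (d : ℕ) (d≤N : d ≤ N) (cs : List ℕ) (p : ℕ) (j : ℕ) where

    value : List ℕ → List ℕ → ℕ → ℕ
    value xs ys u = columnCount d xs (λ zs → tableCount cs (zs ++ ys)) u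

    -- The chosen row is permuted to the front. Its new residual `y` then moves past `zs` to join
    -- the treated rows, by the symmetry of `tableCount`.
    value-step : ∀ {xs xs′ ys s} u → xs ↭ s ∷ xs′ →
                 value xs ys u ≡ spread s u (λ y v → value xs′ (y ∷ ys) v)
    value-step {xs} {xs′} {ys} {s} u p =
      columnCount-↭ d (λ q → tableCount-↭ cs (++⁺ʳ ys q)) p u
      ∙ spread-cong s u λ y → columnCount-cong d xs′ λ zs → tableCount-↭ cs (↭-sym (shift y zs ys))

    -- The entries below S are those without untreated rows, filled in by startColumn.
    Computed : (ℕ → ℕ) → ℕ → Set
    Computed F z = ∀ {xs ys u} → Valid xs ys u → index xs ys u < z ⊎ index xs ys u < S →
                   F (p + index xs ys u) ≡ value xs ys u

    -- Later layers must start out as 0, since `startColumn` writes only entries whose used part is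
    -- the column sum.
    Blank : (ℕ → ℕ) → Set
    Blank F = ∀ i → p + L ≤ i → F i ≡ 0

    Position : ℕ → ℕ → State → Set
    Position z k s = Ready s × var s columns ≡ j × var s source ≡ p × var s counter ≡ k ×
                     var s offset ≡ z × var s position ≡ p + z × z + k ≡ L

    module Entry (z k : ℕ) (z<L : z < L) where

      Before After : State → Set
      Before s = Position z k s × Computed (arr s counts) z × Blank (arr s counts)
      After s = Position z k s × Computed (arr s counts) (suc z) × Blank (arr s counts)

      skip-entry : ∀ {s} → z < B ^ suc (ρ + 0) → Before s → After s
      skip-entry {s} z< (pos , comp , blank) = pos , comp′ , blank
        where
        comp′ : Computed (arr s counts) (suc z)
        comp′ v (inj₁ l) = comp v (inj₂ (≤-trans l (subst (λ e → z < B ^ suc e) (+-identityʳ ρ) z<)))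
        comp′ v (inj₂ l) = comp v (inj₂ l)

      store-entry : ∀ {F} σ → Computed F z → Blank F →
                    B ^ (ρ + suc σ) ≤ z → z < B ^ suc (ρ + suc σ) →
                    let F′ = update F (p + z) (spread (suc σ) 0 λ y v →
                               F (p + z ∸ B ^ (ρ + suc σ) + v + weight 0 y)) in
                    Computed F′ (suc z) × Blank F′
      store-entry {F} σ comp blank lo hi = comp′ , blank′
        where
        new = spread (suc σ) 0 λ y v → F (p + z ∸ B ^ (ρ + suc σ) + v + weight 0 y)
        blank′ : Blank (update F (p + z) new)
        blank′ i l = update-≢ F new (λ e → <⇒≱ (+-monoʳ-< p z<L) (subst (p + L ≤_) (sym e) l)) ∙ blank i l
        new≡ : ∀ {xs ys u} → Valid xs ys u → index xs ys u ≡ z → new ≡ value xs ys u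
        new≡ {xs} {ys} {u} v refl
          with xs′ , perm ← extract-largest σ v lo hi =
          reindex
          ∙ spread-cong-+ (suc σ) u (λ t y e →
              cong F (q≡ t y) ∙ comp (vstep t y e) (inj₁ (idx< t y e)))
          ∙ sym (value-step u perm)
          where
          W = B ^ (ρ + suc σ)
          K = code 0 ys + code ρ xs′
          index≡ : index xs ys u ≡ index (suc σ ∷ xs′) ys u
          index≡ = cong (λ q → u + (code 0 ys + q)) (code-↭ ρ perm)
          -- Subtracting `W` deletes the largest untreated row from the state.
          base≡ : p + index xs ys u ∸ W ≡ p + K + u
          base≡ = cong (_∸ W) (cong (p +_) index≡ ∙ regroup p u (code 0 ys) W (code ρ xs′)) ∙ m+n∸n≡m (p + K + u) W
            where
            regroup : ∀ p u a w b → p + (u + (a + (w + b))) ≡ p + (a + b) + u + w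
            regroup = solve-∀
          -- The address already contains `u`, so the sum started at 0 is shifted to start at `u`.
          reindex : new ≡ spread (suc σ) u (λ y v → F (p + K + v + weight 0 y))
          reindex = spread-cong (suc σ) 0 (λ y v →
                cong (λ q → F (q + v + weight 0 y)) base≡ ∙ cong (λ q → F (q + weight 0 y)) (+-assoc (p + K) u v))
            ∙ spread-shift u (suc σ) 0 (λ y v → F (p + K + v + weight 0 y))
            ∙ cong (λ q → spread (suc σ) q (λ y v → F (p + K + v + weight 0 y))) (+-identityʳ u)
          q≡ : ∀ t y → p + K + (u + t) + weight 0 y ≡ p + index xs′ (y ∷ ys) (u + t)
          q≡ t y = regroup p K (u + t) (weight 0 y) ∙ cong (p +_) (sym (step-index xs′ ys (u + t) y))
            where
            regroup : ∀ a b c d → a + b + c + d ≡ a + (b + c + d)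
            regroup = solve-∀
          vstep : ∀ t y → t + y ≡ suc σ → Valid xs′ (y ∷ ys) (u + t)
          vstep t y e = valid-step t y (subst (λ q → Valid (q ∷ xs′) ys u) (sym e) (valid-↭ perm v))
          idx< : ∀ t y → t + y ≡ suc σ → index xs′ (y ∷ ys) (u + t) < index xs ys u
          idx< t y e = subst (index xs′ (y ∷ ys) (u + t) <_) (sym index≡)
                             (step-index< 1≤N 1≤ρ xs′ ys u t y σ e)
        comp′ : Computed (update F (p + z) new) (suc z)
        -- Several states may share the index `z`; `new≡` gives the right value for each of them.
        comp′ {xs} {ys} {u} v l with index xs ys u ≟ z
        ... | yes e = cong (update F (p + z) new ∘ (p +_)) e ∙ update-≡ F (p + z) new ∙ new≡ v e
        ... | no ne = update-≢ F new (ne ∘ sym ∘ +-cancelˡ-≡ p z _) ∙ comp v (smaller l)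
          where
          smaller : index xs ys u < suc z ⊎ index xs ys u < S → index xs ys u < z ⊎ index xs ys u < S
          smaller (inj₁ q) = inj₁ (≤∧≢⇒< (≤-pred q) ne)
          smaller (inj₂ q) = inj₂ q

      Mid : (ℕ → ℕ) → State → Set
      Mid F s = Position z k s × arr s counts ≡ F

      -- The bound on `z` records that the weights of all larger residuals were tested and exceed
      -- `z`. The first success therefore identifies the leading digit.
      updateEntry-runs : ∀ σ s → σ ≤ ρ → z < B ^ suc (ρ + σ) → Before s →
                         Runs (updateEntry ρ σ) s (updateTime σ) After
      updateEntry-runs zero s _ z< h = last skip (skip-entry {s} z< h)
      updateEntry-runs (suc σ) s σ≤ z< h@(pos@(ready@((one≡ , _) , _ , _ , _ , _ , w≡) , _ , _ , _ , o≡ , q≡ , _) , comp , blank) =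
        const ⟫ load ⟫ add ⟫ sub ⟫ branch (W ≤? z)
        where
        W = B ^ (ρ + suc σ)
        F = arr s counts
        w : arr s weights (ρ + suc σ) ≡ W
        w = w≡ (ρ + suc σ) (≤-trans (+-monoʳ-≤ ρ σ≤) (n≤1+n _)) ∙ cong (weight 0) (+-suc ρ σ) ∙ cong (B ^_) (sym (+-suc ρ σ))
        s₄ = setVar (setVar (setVar (setVar s tmp (ρ + suc σ)) tmp (arr s weights (ρ + suc σ)))
               ptr (var s offset + var s one)) ptr (var s offset + var s one ∸ arr s weights (ρ + suc σ))
        test≡ : var s₄ ptr ≡ suc z ∸ W
        test≡ = cong₂ _∸_ (cong₂ _+_ o≡ one≡ ∙ +-comm z 1) w
        branch : Dec (W ≤ z) → Runs (ifNonzero ptr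
          then (ptr ≔ position ⊟ tmp ⨾ acc ≔const 0 ⨾ addTerms (suc σ) ⨾ store counts [ position ]≔ acc)
          else updateEntry ρ σ) s₄ (suc (2 + (termTime (suc σ) + 1) + updateTime σ)) After
        branch (yes lo) = slower (s≤s (m≤m+n _ (updateTime σ)))
          (ifYes (λ e → <⇒≱ (s≤s lo) (m∸n≡0⇒m≤n (sym test≡ ∙ e)))
            (sub ⟫ const ⟫ bind
              (addTerms-runs (Mid F) (λ h → h) (λ h → h) (λ h → h) (proj₁ ∘ proj₁) F
                 (p + z ∸ W) (suc σ) 0 0 _ (s≤s (≤-trans (≤-trans (n≤1+n σ) σ≤) (m≤m+n ρ ρ)))
                 (cong₂ _∸_ q≡ w ∙ sym (+-identityʳ _)) refl refl (pos , refl))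
              λ { s′ ((pos′@(_ , _ , _ , _ , _ , q≡′ , _) , F≡) , a≡) →
                  last store (pos′ , subst (λ G → Computed G (suc z) × Blank G)
                    (sym (cong₂ (λ G v → update G (var s′ position) v) F≡ a≡
                          ∙ cong (λ i → update F i _) q≡′))
                    (store-entry σ comp blank lo z<)) }))
        branch (no hi) = slower (s≤s (m≤n+m (updateTime σ) _))
          (ifNo (test≡ ∙ m≤n⇒m∸n≡0 (≰⇒> hi))
            (updateEntry-runs σ s₄ (≤-trans (n≤1+n σ) σ≤) (subst (λ e → z < B ^ e) (+-suc ρ σ) (≰⇒> hi)) h))

    FillInvariant : ℕ → State → Set
    FillInvariant k s = Σ[ z ∈ ℕ ] Position z k s × Computed (arr s counts) z × Blank (arr s counts)

    fillEntry-runs : ∀ k s → FillInvariant (suc k) s → Runs (fillEntry ρ) s (updateTime ρ + 3) (FillInvariant k)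
    fillEntry-runs k s (z , pos@(_ , _ , _ , _ , _ , _ , z+k≡) , comp , blank) =
      bind (Entry.updateEntry-runs z (suc k) z<L ρ s ≤-refl z<L (pos , comp , blank))
      λ { s′ ((ready@((one≡ , _) , _) , cols , src , k≡ , o≡ , q≡ , _) , comp′ , blank′) →
          add ⟫ add ⟫ last sub (suc z ,
            (ready , cols , src , cong₂ _∸_ k≡ one≡ ,
             (cong₂ _+_ o≡ one≡ ∙ +-comm z 1) ,
             (cong₂ _+_ q≡ one≡ ∙ +-assoc p z 1 ∙ cong (p +_) (+-comm z 1)) ,
             (sym (+-suc z k) ∙ z+k≡)) , comp′ , blank′) }
      where
      z<L : z < L
      z<L = subst (suc z ≤_) z+k≡ (subst (suc z ≤_) (sym (+-suc z k)) (s≤s (m≤m+n z k)))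

    module Start (p₀ : ℕ) (p≡ : p ≡ p₀ + L) (F₀ : ℕ → ℕ) (layer : Layer cs p₀ F₀)
                 (blank : ∀ i → p ≤ i → F₀ i ≡ 0) where

      Copied : (ℕ → ℕ) → ℕ → Set
      Copied F w = (∀ v → v < w → F (p + d + v * B) ≡ F₀ (p₀ + v * S)) ×
                   (∀ i → (∀ v → v < B ^ ρ → i ≢ p + d + v * B) → F i ≡ F₀ i)

      copy-next : ∀ {F w} → w < B ^ ρ → Copied F w →
                  Copied (update F (p + d + w * B) (F (p₀ + w * S))) (suc w)
      copy-next {F} {w} w< (old , same) = old′ , same′
        where
        -- Reads stay in the previous layer, below `p`, and writes are at `p` or later, so no entry
        -- is overwritten before it is read.
        before : ∀ v → p₀ + w * S ≢ p + d + v * B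
        before v e = <⇒≢ (≤-trans (+-monoʳ-< p₀ w*S<L) (≤-trans (≤-reflexive (sym p≡))
                           (≤-trans (m≤m+n p d) (m≤m+n (p + d) (v * B))))) e
          where
          w*S<L : w * S < L
          w*S<L = subst (w * S <_) (sym (^-distribˡ-+-* B ρ (suc ρ)) ∙ cong (B ^_) (+-suc ρ ρ))
                        (*-monoˡ-< S {{m^n≢0 B (suc ρ)}} w<)
        old′ : ∀ v → v < suc w → update F (p + d + w * B) (F (p₀ + w * S)) (p + d + v * B) ≡ F₀ (p₀ + v * S)
        old′ v v< with v ≟ w
        ... | yes refl = update-≡ F (p + d + w * B) (F (p₀ + w * S)) ∙ same _ (λ v _ → before v)
        ... | no ne = update-≢ F (F (p₀ + w * S)) (λ e → ne (sym (*-cancelʳ-≡ w v B (+-cancelˡ-≡ (p + d) _ _ e))))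
                      ∙ old v (≤∧≢⇒< (≤-pred v<) ne)
        same′ : ∀ i → (∀ v → v < B ^ ρ → i ≢ p + d + v * B) →
                update F (p + d + w * B) (F (p₀ + w * S)) i ≡ F₀ i
        same′ i ne = update-≢ F (F (p₀ + w * S)) (ne w w< ∘ sym) ∙ same i ne

      -- Below `S` no untreated row has a positive residual, so the count is 0 unless `u` equals
      -- `d`. In that case the entry was copied from the previous layer; otherwise it was never
      -- written.
      copied⇒computed : ∀ {F} → Copied F (B ^ ρ) → Computed F 0 × Blank F
      copied⇒computed {F} (old , same) = comp , blank′
        where
        blank′ : Blank F
        blank′ i l = same i (λ v v< e → <⇒≱ (small v v<) (subst (p + L ≤_) e l)) ∙ blank i (≤-trans (m≤m+n p L) l)
          where
          small : ∀ v → v < B ^ ρ → p + d + v * B < p + L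
          small v v< = begin-strict
            p + d + v * B    ≡⟨ +-assoc p d _ ⟩
            p + (d + v * B)  <⟨ +-monoʳ-< p (+-monoˡ-< (v * B) (s≤s d≤N)) ⟩
            p + (B + v * B)  ≤⟨ +-monoʳ-≤ p (*-monoˡ-≤ B v<) ⟩
            p + B ^ ρ * B    ≡⟨ cong (p +_) (*-comm (B ^ ρ) B) ⟩
            p + S            ≤⟨ +-monoʳ-≤ p (^-monoʳ-≤ B (s≤s (m≤m+n ρ ρ))) ⟩
            p + L            ∎
            where open ≤-Reasoning
        comp : Computed F 0
        comp {xs} {ys} {u} v@(valid ps qs t≤) (inj₂ i<) with w , w≡ ← code-multiple ys =
          cong F pos≡ ∙ entry ∙ sym (sum≡0⇒columnCount d xs (λ zs → tableCount cs (zs ++ ys)) u xs≡0)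
          where
          xs≡0 : sumˡ xs ≡ 0
          xs≡0 = index<⇒sum≡0 {xs} ys u i<
          index≡ : index xs ys u ≡ u + w * B
          index≡ = cong (u +_) (cong₂ _+_ w≡ (sum≡0⇒code≡0 ρ xs xs≡0) ∙ +-identityʳ _)
          pos≡ : p + index xs ys u ≡ p + u + w * B
          pos≡ = cong (p +_) index≡ ∙ sym (+-assoc p u _)
          w< : w < B ^ ρ
          w< = *-cancelˡ-< B w (B ^ ρ) (≤-trans (s≤s (≤-trans (≤-reflexive (*-comm B w)) (m≤n+m (w * B) u)))
                 (subst (_< S) index≡ i<))
          u< : u < B
          u< = s≤s (≤-trans (m≤m+n u _) t≤)
          codes : code ρ (xs ++ ys) ≡ w * S
          codes = code-++ ρ xs ys ∙ cong₂ _+_ (sum≡0⇒code≡0 ρ xs xs≡0) (code-shift ρ ys ∙ cong (B ^ ρ *_) w≡)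
                  ∙ regroup (B ^ ρ) w B
            where
            regroup : ∀ a b c → a * (b * c) ≡ b * (c * a)
            regroup = solve-∀
          entry : F (p + u + w * B) ≡ (if u ≡ᵇ d then tableCount cs (xs ++ ys) else 0)
          entry with u ≟ d
          ... | yes refl = old w w< ∙ cong (F₀ ∘ (p₀ +_)) (sym codes)
              ∙ layer (xs ++ ys) (All-++ ps qs)
                  (≤-trans (≤-reflexive (sum-++ xs ys ∙ +-comm (sumˡ xs) (sumˡ ys))) (≤-trans (m≤n+m _ u) t≤))
              ∙ sym (if-refl u _)
          ... | no ne = same _ (λ v _ e → ne (residue v e)) ∙ blank _ (≤-trans (m≤m+n p u) (m≤m+n (p + u) _))
              ∙ sym (if-≢ _ ne)
            where
            -- Both `u` and `d` are below `B`, so they are the residues modulo `B` of the two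
            -- offsets from `p`.
            residue : ∀ v → p + u + w * B ≡ p + d + v * B → u ≡ d
            residue v e = sym (m<n⇒m%n≡m u<) ∙ sym ([m+kn]%n≡m%n u w B)
              ∙ cong (_% B) (+-cancelˡ-≡ p _ _ (sym (+-assoc p u _) ∙ e ∙ +-assoc p d _))
              ∙ [m+kn]%n≡m%n d v B ∙ m<n⇒m%n≡m (s≤s d≤N)

      StartInvariant : ℕ → State → Set
      StartInvariant k s = Σ[ w ∈ ℕ ] w + k ≡ B ^ ρ × Ready s × var s columns ≡ j × var s counter ≡ k ×
        var s source ≡ p₀ + w * S × var s target ≡ p + d + w * B × var s position ≡ p × Copied (arr s counts) w

      startColumn-runs : ∀ k s → StartInvariant (suc k) s → Runs startColumn s 5 (StartInvariant k)
      startColumn-runs k s (w , w+k≡ , ready@((one≡ , _) , B≡ , S≡ , _) , cols , k≡ , s≡ , t≡ , q≡ , copied) =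
        load ⟫ store ⟫ add ⟫ add ⟫ last sub
          (suc w , (sym (+-suc w k) ∙ w+k≡) , ready , cols , cong₂ _∸_ k≡ one≡ ,
           (cong₂ _+_ s≡ S≡ ∙ +-assoc p₀ _ _ ∙ cong (p₀ +_) (+-comm _ S)) ,
           (cong₂ _+_ t≡ B≡ ∙ +-assoc (p + d) _ _ ∙ cong (p + d +_) (+-comm _ B)) , q≡ ,
           subst (λ G → Copied G (suc w))
             (sym (cong₂ (λ t v → update (arr s counts) t (arr s counts v)) t≡ s≡))
             (copy-next w< copied))
        where
        w< : w < B ^ ρ
        w< = subst (suc w ≤_) w+k≡ (subst (suc w ≤_) (sym (+-suc w k)) (s≤s (m≤m+n w k)))

    computed⇒layer : ∀ {F} → Computed F L → Layer (d ∷ cs) p F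
    computed⇒layer comp xs ps s≤ =
      comp v (inj₁ (index< ρ v ps))
      ∙ columnCount-cong d xs (λ zs → cong (tableCount cs) (++-identityʳ zs)) 0
      where
      v : Valid xs [] 0
      v = valid ps [] s≤

  layerTime : ℕ
  layerTime = 5 + (suc (B ^ ρ * suc 5) + (2 + suc (L * suc (updateTime ρ + 3))))

  -- `source` is the start of the layer finished last, and `position` that of the next one.
  Outer : ℕ → State → Set
  Outer k s = var s columns ≡ k × k ≤ n × Ready s × var s position ≡ var s source + L ×
              Layer (drop k (toList c)) (var s source) (arr s counts) ×
              (∀ i → var s source + L ≤ i → arr s counts i ≡ 0)

  fillLayer-runs : ∀ k s → Outer (suc k) s → Runs (fillLayer ρ) s layerTime (Outer k)
  fillLayer-runs k s (cols , k≤ , ready@((one≡ , null≡ , _ , colArr≡) , _ , _ , L≡ , _ , w≡) , pos , layer , blank) =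
    sub ⟫ load ⟫ add ⟫ const ⟫ load ⟫
    bind (countdown S.StartInvariant (λ (_ , _ , _ , _ , k≡ , _) → k≡) S.startColumn-runs (B ^ ρ) _
      (0 , refl , ready , k≡ , (w≡ ρ (≤-trans (m≤m+n ρ ρ) (n≤1+n _)) ∙ weight-pos 1≤ρ) ,
       sym (+-identityʳ _) , (cong (var s position +_) d≡ ∙ sym (+-identityʳ _)) , refl ,
       (λ _ ()) , λ _ _ → refl))
    λ { s′ (w , w≡ , ready′@((_ , null≡′ , _) , _ , _ , L≡′ , _) , cols′ , _ , src′ , _ , pos′ , copied) →
      const ⟫ add ⟫ mapPost
        (λ { {s″} (z , (ready″ , cols″ , src″ , _ , _ , pos″ , z≡) , comp , blank″) →
             let z≡L = sym (+-identityʳ z) ∙ z≡ in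
             cols″ , ≤-trans (n≤1+n k) k≤ , ready″ , (pos″ ∙ cong₂ _+_ (sym src″) z≡L) ,
             subst₂ (λ cs q → Layer cs q (arr s″ counts)) (sym (drop-contents c k k≤)) (sym src″)
               (FL.computed⇒layer {arr s″ counts} (subst (FL.Computed (arr s″ counts)) z≡L comp)) ,
             λ i l → blank″ i (subst (λ q → q + L ≤ i) src″ l) })
        (countdown FL.FillInvariant (λ (_ , (_ , _ , _ , k≡ , _) , _) → k≡) FL.fillEntry-runs L _
          (0 , (ready′ , cols′ ,
                (src′ ∙ cong (λ w → var s source + w * S) (sym (+-identityʳ w) ∙ w≡)
                 ∙ cong (var s source +_) S*≡L ∙ sym pos) ,
                (cong₂ _+_ L≡′ null≡′ ∙ +-identityʳ L) , refl , (pos′ ∙ sym (+-identityʳ _)) , refl) ,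
           S.copied⇒computed (subst (S.Copied (arr s′ counts)) (sym (+-identityʳ w) ∙ w≡) copied))) }
    where
    k≡ : var s columns ∸ var s one ≡ k
    k≡ = cong₂ _∸_ cols one≡
    d = contents c k
    d≡ : arr s columnSum (var s columns ∸ var s one) ≡ d
    d≡ = cong₂ (λ f i → f i) colArr≡ k≡
    S*≡L : B ^ ρ * S ≡ L
    S*≡L = sym (^-distribˡ-+-* B ρ (suc ρ)) ∙ cong (B ^_) (+-suc ρ ρ)
    module FL = FillLayer d (contents-All c columns≤N k k≤) (drop (suc k) (toList c)) (var s position) k
    module S = FL.Start (var s source) pos (arr s counts) layer
                        (λ i l → blank i (subst (_≤ i) pos l))

  -- Initialisation, final lookup and the whole run.

  Initialised : State → Set
  Initialised s = Common s × var s base ≡ B × var s rowsLeft ≡ m × var s columns ≡ n ×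
                  var s source ≡ 0 × (∀ i → arr s counts i ≡ 0)

  Weighted : ℕ → State → Set
  Weighted e s = Initialised s × var s acc ≡ B ^ e × (∀ i → i ≤ e → arr s weights i ≡ weight 0 i)

  fillTime : ℕ → ℕ
  fillTime zero    = 1
  fillTime (suc f) = 2 + (suc (B * suc 2) + 1) + (2 + fillTime f)

  multiplyByBase-runs : ∀ e s → Weighted e s →
    Runs multiplyByBase s (2 + (suc (B * suc 2) + 1))
      λ s′ → Initialised s′ × var s′ acc ≡ B ^ suc e × (∀ i → i ≤ e → arr s′ weights i ≡ weight 0 i)
  multiplyByBase-runs e s (init@((_ , null≡ , _) , B≡ , _) , acc≡ , w≡) =
    add ⟫ const ⟫
    bind (countdown I (λ (_ , k≡ , _) → k≡)
           (λ { k s (init@((one≡ , _) , _) , k≡ , acc≡ , p≡ , w≡) → add ⟫ last sub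
                (init , cong₂ _∸_ k≡ one≡ , acc≡ ,
                 (cong (λ q → var s ptr + q + k * B ^ e) acc≡ ∙ +-assoc (var s ptr) _ _ ∙ p≡) , w≡) })
           B _ (init , (cong₂ _+_ B≡ null≡ ∙ +-identityʳ B) , acc≡ , refl , w≡))
    λ { s′ (init@((_ , null≡ , _) , _) , _ , _ , p≡ , w≡) →
        last add (init , (cong (var s′ ptr +_) null≡ ∙ p≡) , w≡) }
    where
    I : ℕ → State → Set
    I k s = Initialised s × var s counter ≡ k × var s acc ≡ B ^ e × var s ptr + k * B ^ e ≡ B * B ^ e ×
            (∀ i → i ≤ e → arr s weights i ≡ weight 0 i)

  fillWeights-runs : ∀ e f {E} s → e + f ≡ E → Weighted e s → Runs (fillWeights e f) s (fillTime f) (Weighted E)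
  fillWeights-runs e zero s refl h =
    last skip (subst (λ e → Weighted e s) (sym (+-identityʳ e)) h)
  fillWeights-runs e (suc f) s e+f≡ h =
    bind (multiplyByBase-runs e s h) λ { s′ (init , acc≡ , w≡) →
      const ⟫ store ⟫ fillWeights-runs (suc e) f _ (sym (+-suc e f) ∙ e+f≡)
        (init , acc≡ , λ i i≤ → stored (arr s′ weights) (var s′ acc) acc≡ w≡ i i≤) }
    where
    stored : ∀ W a → a ≡ B ^ suc e → (∀ i → i ≤ e → W i ≡ weight 0 i) →
             ∀ i → i ≤ suc e → update W (suc e) a i ≡ weight 0 i
    stored W a a≡ w≡ i i≤ with i ≟ suc e
    ... | yes refl = update-≡ W i a ∙ a≡
    ... | no ne = update-≢ W a (ne ∘ sym) ∙ w≡ i (≤-pred (≤∧≢⇒< i≤ ne))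

  SumInvariant : ℕ → State → Set
  SumInvariant k s = Common s × var s counter ≡ k × var s rowsLeft ≡ m × var s columns ≡ n ×
    var s source ≡ 0 × (∀ i → arr s counts i ≡ 0) × arr s weights 0 ≡ 0 ×
    var s base + partialSum (contents r) k ≡ B

  addRowSum-runs : ∀ k s → SumInvariant (suc k) s → Runs addRowSum s 3 (SumInvariant k)
  addRowSum-runs k s (common@(one≡ , _ , row≡ , _) , k≡ , rows , cols , src , tab , w≡ , sum≡) =
    sub ⟫ load ⟫ last add
      (common , cong₂ _∸_ k≡ one≡ , rows , cols , src , tab , w≡ ,
       (cong₂ (λ f i → var s base + f i + partialSum (contents r) k) row≡ (cong₂ _∸_ k≡ one≡)
        ∙ +-assoc (var s base) _ _ ∙ sum≡))

  FinalInvariant : ℕ → ℕ → (ℕ → ℕ) → ℕ → State → Set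
  FinalInvariant p col F k s = var s rowsLeft ≡ k × k ≤ m × var s columns ≡ col × var s one ≡ 1 ×
    arr s rowSum ≡ contents r × arr s counts ≡ F ×
    (∀ e → e ≤ suc (ρ + ρ) → arr s weights e ≡ weight 0 e) ×
    var s source + partialSum (weight ρ ∘ contents r) k ≡ p + code ρ (toList r)

  addRowWeight-runs : ∀ p col F k s → FinalInvariant p col F (suc k) s →
                      Runs (addRowWeight ρ) s 6 (FinalInvariant p col F k)
  addRowWeight-runs p col F k s (k≡ , k≤ , cols , one≡ , row≡ , tab , w≡ , sum≡) =
    sub ⟫ load ⟫ const ⟫ add ⟫ load ⟫ last add
      (cong₂ _∸_ k≡ one≡ , ≤-trans (n≤1+n k) k≤ , cols , one≡ , row≡ , tab , w≡ ,
       (cong (λ q → var s source + q + partialSum (weight ρ ∘ contents r) k) new≡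
        ∙ +-assoc (var s source) _ _ ∙ sum≡))
    where
    rₖ = contents r k
    -- For `x` equal to 0 the left side is `B ^ ρ` and the right side 0; here the positivity of the
    -- row sums enters.
    pos : ∀ {x} → 1 ≤ x → weight 0 (ρ + x) ≡ weight ρ x
    pos {suc x} _ = cong (weight 0) (+-suc ρ x) ∙ cong (B ^_) (sym (+-suc ρ x))
    new≡ : arr s weights (ρ + arr s rowSum (var s rowsLeft ∸ var s one)) ≡ weight ρ rₖ
    new≡ = cong₂ (λ f i → arr s weights (ρ + f i)) row≡ (cong₂ _∸_ k≡ one≡)
      ∙ w≡ (ρ + rₖ) (≤-trans (+-monoʳ-≤ ρ (contents-All r rows≤ρ k k≤)) (n≤1+n _))
      ∙ pos (contents-All r rows≥1 k k≤)

  totalTime : ℕ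
  totalTime = 3 + (suc (m * suc 3) + (1 + (fillTime (suc (ρ + ρ)) +
                (5 + (suc (n * suc layerTime) + (suc (m * suc 6) + 1))))))

  -- Code 0 belongs exactly to the lists of zeros, the only row sums of a table without columns.
  emptyLayer : ∀ {W z a F} → z ≡ 0 → a ≡ 1 → W ≡ 0 → (∀ i → F i ≡ 0) → Layer [] W (update F z a)
  emptyLayer {F = F} refl refl refl blank xs _ _ with sumˡ xs ≟ 0
  ... | yes e = cong (update F 0 1) (sum≡0⇒code≡0 ρ xs e) ∙ sym (cong (λ q → if q ≡ᵇ 0 then 1 else 0) e)
  ... | no ne = update-≢ F 1 (ne ∘ code≡0⇒sum≡0 ρ xs ∘ sym) ∙ blank _ ∙ sym (if-≢ 1 ne)

  countTables-runs : Runs (countTables ρ) (input r c) totalTime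
                       λ s → var s 0 ≡ tableCount (toList c) (toList r) × var s 1 ≡ 0
  countTables-runs =
    const ⟫ const ⟫ add ⟫
    bind (countdown SumInvariant (λ (_ , k≡ , _) → k≡) addRowSum-runs m _
           ((refl , refl , refl , refl) , +-identityʳ m , refl , refl , refl , (λ _ → refl) , refl ,
            cong suc (partialSum-contents (λ x → x) r ∙ cong sumˡ (map-id (toList r)) ∙ sum-r)))
    λ { s₁ (common , _ , rows , cols , src , tab , w≡ , b≡) →
    const ⟫
    bind (fillWeights-runs 0 (suc (ρ + ρ)) _ refl
           ((common , (sym (+-identityʳ _) ∙ b≡) , rows , cols , src , tab) , refl , λ { .0 z≤n → w≡ }))
    λ { s₂ ((common@(one≡ , null≡ , _) , b≡ , rows , cols , src , tab) , acc≡ , w≡) →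
    add ⟫ add ⟫ const ⟫ load ⟫ store ⟫
    bind (countdown Outer proj₁ fillLayer-runs n _
      (cols , ≤-refl ,
       (common , b≡ , w≡ (suc ρ) (s≤s (m≤m+n ρ ρ)) , (cong₂ _+_ acc≡ null≡ ∙ +-identityʳ L) , rows , w≡) ,
       (cong₂ _+_ acc≡ null≡ ∙ +-identityʳ L ∙ cong (_+ L) (sym src)) ,
       subst (λ cs → Layer cs (var s₂ source) (update (arr s₂ counts) (var s₂ null) (var s₂ one)))
             (sym (drop-all c)) (emptyLayer null≡ one≡ src tab) ,
       λ i l → update-≢ (arr s₂ counts) (var s₂ one)
                 (λ e → <⇒≱ (m^n>0 B (suc (ρ + ρ)))
                          (≤-trans (m≤n+m L (var s₂ source)) (≤-trans l (≤-reflexive (sym e ∙ null≡))))) ∙ tab i))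
    λ { s₃ (cols , _ , ((one≡ , _ , row≡ , _) , _ , _ , _ , rows , w≡) , _ , layer , _) →
    bind (countdown (FinalInvariant (var s₃ source) 0 (arr s₃ counts)) proj₁
           (addRowWeight-runs (var s₃ source) 0 (arr s₃ counts)) m _
           (rows , ≤-refl , cols , one≡ , row≡ , refl , w≡ ,
            cong (var s₃ source +_) (partialSum-contents (weight ρ) r)))
    λ { s₄ (_ , _ , cols , _ , _ , tab , _ , src) →
    last load
      ((cong₂ (λ f i → f i) tab (sym (+-identityʳ _) ∙ src)
        ∙ layer (toList r) rows≤ρ (≤-reflexive sum-r)) , cols) }}}}

-- Running time

-- This and the next two constants are the time bounds with `m`, `n` and the powers of `B` replaced
-- by 1.
fillConst : ℕ → ℕ
fillConst zero    = 1
fillConst (suc f) = 2 + (1 + 3 + 1) + (2 + fillConst f)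

layerConst : ℕ → ℕ
layerConst ρ = 5 + (1 + 6 + (2 + (1 + suc (updateTime ρ + 3))))

timeConst : ℕ → ℕ
timeConst ρ = 3 + (1 + 4 + (1 + (fillConst (suc (ρ + ρ)) +
  (5 + (1 + suc (layerConst ρ) + (1 + 7 + 1))))))

-- A record, since k cannot be inferred from a ≤ k * Z by unification.
record _≤[_]_ (a Z k : ℕ) : Set where
  constructor bounded
  field bound : a ≤ k * Z
open _≤[_]_

const≤ : ∀ k {Z} .{{_ : NonZero Z}} → k ≤[ Z ] k
const≤ k {Z} = bounded (m≤m*n k Z)

scale≤ : ∀ {a Z} k → a ≤ Z → (a * k) ≤[ Z ] k
scale≤ {a} k p = bounded (≤-trans (≤-reflexive (*-comm a k)) (*-monoʳ-≤ k p))

infixr 6 _⊕_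
_⊕_ : ∀ {Z a b x y} → a ≤[ Z ] x → b ≤[ Z ] y → (a + b) ≤[ Z ] (x + y)
_⊕_ {Z} {x = x} {y} (bounded p) (bounded q) =
  bounded (≤-trans (+-mono-≤ p q) (≤-reflexive (sym (*-distribʳ-+ Z x y))))

module Time (N ρ : ℕ) (1≤N : 1 ≤ N) (1≤ρ : 1 ≤ ρ) {m n : ℕ} (r : Vec ℕ m) (c : Vec ℕ n)
            (rows≥1 : Allˡ (1 ≤_) (toList r)) (rows≤ρ : Allˡ (_≤ ρ) (toList r))
            (columns≤N : Allˡ (_≤ N) (toList c)) (sum-r : sumˡ (toList r) ≡ N)
            (m≤N : m ≤ N) (n≤N : n ≤ N) where
  open Machine N ρ 1≤N 1≤ρ r c rows≥1 rows≤ρ columns≤N sum-r public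

  -- One factor `L` pays for the time of a layer, the other for the number of layers.
  Z : ℕ
  Z = L * L

  instance
    L≢0 : NonZero L
    L≢0 = m^n≢0 B (suc (ρ + ρ))

    Z≢0 : NonZero Z
    Z≢0 = m*n≢0 L L

  1≤L : 1 ≤ L
  1≤L = m^n>0 B (suc (ρ + ρ))

  L≤Z : L ≤ Z
  L≤Z = m≤m*n L L

  B≤L : B ≤ L
  B≤L = ≤-trans (≤-reflexive (sym (*-identityʳ B))) (*-monoʳ-≤ B (m^n>0 B (ρ + ρ)))

  N≤L : N ≤ L
  N≤L = ≤-trans (n≤1+n N) B≤L

  fill≤ : ∀ f → fillTime f ≤[ Z ] fillConst f
  fill≤ zero    = const≤ 1
  fill≤ (suc f) = (const≤ 2 ⊕ ((const≤ 1 ⊕ scale≤ 3 (≤-trans B≤L L≤Z)) ⊕ const≤ 1)) ⊕ (const≤ 2 ⊕ fill≤ f)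

  layer≤ : layerTime ≤[ L ] layerConst ρ
  layer≤ = const≤ 5 ⊕ (const≤ 1 ⊕ scale≤ 6 (^-monoʳ-≤ B (≤-trans (m≤m+n ρ ρ) (n≤1+n _)))) ⊕
           const≤ 2 ⊕ const≤ 1 ⊕ scale≤ (suc (updateTime ρ + 3)) ≤-refl

  layers≤ : (n * suc layerTime) ≤[ Z ] suc (layerConst ρ)
  layers≤ = bounded (≤-trans (*-mono-≤ (≤-trans n≤N N≤L) (+-mono-≤ 1≤L (bound layer≤)))
                    (≤-reflexive (regroup L (layerConst ρ))))
    where
    regroup : ∀ l k → l * (l + k * l) ≡ (1 + k) * (l * l)
    regroup = solve-∀

  total≤ : totalTime ≤[ Z ] timeConst ρ
  total≤ = const≤ 3 ⊕ (const≤ 1 ⊕ scale≤ 4 m≤Z) ⊕ const≤ 1 ⊕ fill≤ (suc (ρ + ρ)) ⊕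
    const≤ 5 ⊕ (const≤ 1 ⊕ layers≤) ⊕ (const≤ 1 ⊕ scale≤ 7 m≤Z) ⊕ const≤ 1
    where
    m≤Z = ≤-trans m≤N (≤-trans N≤L L≤Z)

n<2^n : ∀ n → n < 2 ^ n
n<2^n zero    = s≤s z≤n
n<2^n (suc n) = ≤-trans (s≤s (n<2^n n))
  (≤-trans (+-monoˡ-≤ (2 ^ n) (m^n>0 2 n)) (≤-reflexive (cong (2 ^ n +_) (sym (+-identityʳ (2 ^ n))))))

-- The first summand absorbs the constant factor, by `K ≤ M ^ K`; the second comes from
-- `B ≤ M ^ suc ρ` and the exponent of `B` in `L * L`.
timeExponent : ℕ → ℕ
timeExponent ρ = timeConst ρ + suc ρ * (suc (ρ + ρ) + suc (ρ + ρ))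

polynomial≤quasiPolynomial : ∀ ρ N m n {t} → N ≤ ρ * m →
  t ≤[ suc N ^ suc (ρ + ρ) * suc N ^ suc (ρ + ρ) ] timeConst ρ → t ≤ quasiPolynomial (timeExponent ρ) m n
polynomial≤quasiPolynomial ρ N m n {t} N≤ (bounded t≤) = begin
  t                              ≤⟨ t≤ ⟩
  K * (B ^ e * B ^ e)            ≡⟨ cong (K *_) (^-distribˡ-+-* B e e) ⟨
  K * B ^ (e + e)                ≤⟨ *-mono-≤ (power≤ K) (^-monoˡ-≤ (e + e) B≤) ⟩
  M ^ K * (M ^ suc ρ) ^ (e + e)  ≡⟨ cong (M ^ K *_) (^-*-assoc M (suc ρ) (e + e)) ⟩
  M ^ K * M ^ (suc ρ * (e + e))  ≡⟨ ^-distribˡ-+-* M K (suc ρ * (e + e)) ⟨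
  -- `n ⊔ 2` is at least 2, so its logarithm is at least 1.
  M ^ C                          ≤⟨ ^-monoʳ-≤ M (m≤m*n C ⌊log₂ (n ⊔ 2) ⌋ {{>-nonZero (⌊log₂⌋-mono-≤ (m≤n⊔m n 2))}}) ⟩
  M ^ (C * ⌊log₂ (n ⊔ 2) ⌋)      ∎
  where
  open ≤-Reasoning
  K = timeConst ρ
  C = timeExponent ρ
  e = suc (ρ + ρ)
  B = suc N
  M = m ⊔ 2
  instance
    M≢0 : NonZero M
    M≢0 = >-nonZero (≤-trans (s≤s z≤n) (m≤n⊔m m 2))
  power≤ : ∀ k → k ≤ M ^ k
  power≤ k = ≤-trans (<⇒≤ (n<2^n k)) (^-monoˡ-≤ k (m≤n⊔m m 2))
  B≤ : B ≤ M ^ suc ρ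
  B≤ = begin
    suc N      ≤⟨ s≤s N≤ ⟩
    1 + ρ * m  ≤⟨ +-mono-≤ (>-nonZero⁻¹ M) (*-monoʳ-≤ ρ (m≤m⊔n m 2)) ⟩
    suc ρ * M  ≤⟨ *-monoˡ-≤ M (≤-trans (n<2^n ρ) (^-monoˡ-≤ ρ (m≤n⊔m m 2))) ⟩
    M ^ ρ * M  ≡⟨ *-comm (M ^ ρ) M ⟩
    M ^ suc ρ  ∎

-- From the exact count to the approximation bound.

^ℚ≤1 : ∀ p .{{_ : NonNegative p}} n → p ℚ.≤ 1ℚ → p ^ℚ n ℚ.≤ 1ℚ
^ℚ≤1 p zero    _ = ℚ.≤-refl
^ℚ≤1 p (suc n) l = ℚ.≤-trans (ℚ.*-monoˡ-≤-nonNeg p (^ℚ≤1 p n l)) (subst (ℚ._≤ 1ℚ) (sym (ℚ.*-identityʳ p)) l)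

-- For the exact value both bounds are the same inequality, which holds because `1ℚ - ε` lies
-- between 0 and 1.
exact-approximates : ∀ {ε} → 0ℚ <ℚ ε → ε <ℚ 1ℚ → ∀ N k → ApproximatesWithin ε N ((ℤ.+ k) ℚ./ 1) k
exact-approximates {ε} 0<ε ε<1 N k = shrinks , shrinks
  where
  α = (ℤ.+ k) ℚ./ 1
  q = 1ℚ ℚ.- ε
  instance
    q≥0 : NonNegative q
    q≥0 = nonNegative (subst (ℚ._≤ q) (ℚ.+-inverseʳ ε) (ℚ.+-monoˡ-≤ (ℚ.- ε) (ℚ.<⇒≤ ε<1)))
    α≥0 : NonNegative α
    α≥0 = ℚ.normalize-nonNeg k 1
  q≤1 : q ℚ.≤ 1ℚ
  q≤1 = subst (q ℚ.≤_) (ℚ.+-identityʳ 1ℚ) (ℚ.+-monoʳ-≤ 1ℚ (ℚ.neg-antimono-≤ (ℚ.<⇒≤ 0<ε)))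
  shrinks : q ^ℚ N ℚ.* α ℚ.≤ α
  shrinks = subst (q ^ℚ N ℚ.* α ℚ.≤_) (ℚ.*-identityˡ α) (ℚ.*-monoʳ-≤-nonNeg α (^ℚ≤1 q N q≤1))

exact-run : ∀ {ε p s T U A k} → 0ℚ <ℚ ε → ε <ℚ 1ℚ → ∀ N →
  Runs p s T (λ s′ → var s′ 0 ≡ k × var s′ 1 ≡ 0) → T ≤ U → HasCardinality A k →
  Σ[ t ∈ ℕ ] Σ[ final ∈ State ] Σ[ k ∈ ℕ ]
    ((p , s ⇓[ t ] final) × (t ≤ U) × HasCardinality A k × ApproximatesWithin ε N (output final) k)
exact-run {ε} {k = k} 0<ε ε<1 N (runs {t} {final} steps t≤T (e₀ , e₁)) T≤U card =
  t , final , k , steps , ≤-trans t≤T T≤U , card ,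
  subst (λ α → ApproximatesWithin ε N α k) (sym (cong₂ (λ a b → (ℤ.+ a) ℚ./ suc b) e₀ e₁))
    (exact-approximates 0<ε ε<1 N k)

sum-toList : ∀ {n} (v : Vec ℕ n) → sumˡ (toList v) ≡ sum v
sum-toList []      = refl
sum-toList (x ∷ v) = cong (x +_) (sum-toList v)

length≤sum : ∀ {n} {v : Vec ℕ n} → All (1 ≤_) v → n ≤ sum v
length≤sum []       = z≤n
length≤sum (p ∷ ps) = +-mono-≤ p (length≤sum ps)

sum≤bound*length : ∀ {b n} {v : Vec ℕ n} → All (_≤ b) v → sum v ≤ b * n
sum≤bound*length [] = z≤n
sum≤bound*length {b} {suc n} (p ∷ ps) =
  ≤-trans (+-mono-≤ p (sum≤bound*length ps)) (≤-reflexive (sym (*-suc b n)))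

entries≤sum : ∀ {n} (v : Vec ℕ n) → Allˡ (_≤ sum v) (toList v)
entries≤sum []      = []
entries≤sum (x ∷ v) = m≤m+n x _ ∷ Allˡ.map (λ p → ≤-trans p (m≤n+m _ x)) (entries≤sum v)

All-toList : ∀ {P : ℕ → Set} {n} {v : Vec ℕ n} → All P v → Allˡ P (toList v)
All-toList []       = []
All-toList (p ∷ ps) = p ∷ All-toList ps

mainTheorem5 : (ε : ℚ) → 0ℚ <ℚ ε → ε <ℚ 1ℚ → (ρ : ℕ) → 1 ≤ ρ →
    Σ[ algorithm ∈ Program ] Σ[ C ∈ ℕ ]
    ((m n N : ℕ) → 1 ≤ m → 1 ≤ n → (r : Vec ℕ m) (c : Vec ℕ n) →
    All (λ rᵢ → (1 ≤ rᵢ) × (rᵢ ≤ ρ)) r → All (λ cⱼ → 1 ≤ cⱼ) c →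
    sum r ≡ N → sum c ≡ N →
    Σ[ t ∈ ℕ ] Σ[ final ∈ State ] Σ[ k ∈ ℕ ]
    ((algorithm , input r c ⇓[ t ] final) ×
    (t ≤ quasiPolynomial C m n) ×
    HasCardinality (ContingencyTable r c) k ×
    ApproximatesWithin ε N (output final) k))
mainTheorem5 ε 0<ε ε<1 ρ 1≤ρ = countTables ρ , timeExponent ρ ,
  λ m n N 1≤m _ r c rows cols sum-r sum-c →
    -- Positive margins bound `m` and `n` by `N`, and row sums of at most `ρ` bound `N` by `ρ * m`;
    -- so a time polynomial in `N` is polynomial in `m`.
    let m≤N = subst (m ≤_) sum-r (length≤sum (All.map proj₁ rows))
        n≤N = subst (n ≤_) sum-c (length≤sum cols)
        module T = Time N ρ (≤-trans 1≤m m≤N) 1≤ρ r c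
                     (All-toList (All.map proj₁ rows)) (All-toList (All.map proj₂ rows))
                     (subst (λ s → Allˡ (_≤ s) (toList c)) sum-c (entries≤sum c))
                     (sum-toList r ∙ sum-r) m≤N n≤N
    in exact-run 0<ε ε<1 N T.countTables-runs
         (polynomial≤quasiPolynomial ρ N m n
           (subst (_≤ ρ * m) sum-r (sum≤bound*length (All.map proj₂ rows))) T.total≤)
         (card-contingencyTable r c)
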